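{- Let $G$ be a simple graph with $m$ edges and girth $g(G)\ge 5$. Then the number $p(G;4)$ of $4$-matchings of $G$ equals $$\frac{1}{24}m^4+\frac14 m^3+\frac{19}{24}m^2-\frac{11}{4}m+\frac18 M_1(G)^2+\frac13 mF(G)-\frac14 m^2M_1(G)+mM_2(G)+\frac14 M_1^4(G)-2M_2(G)-\frac54 mM_1(G)+\frac72 M_1(G)-EM_2(G)-\frac32 F(G),$$ where $M_1(G)^2$ is the square of the number $M_1(G)$.
   Context: All graphs are finite, simple and undirected. A $k$-matching is a set of $k$ pairwise vertex-disjoint edges; $p(G;k)$ is the number of $k$-matchings in $G$. $d_G(v)$ is the degree of $v$; the girth is the length of a shortest cycle (infinite if acyclic). $M_1^\alpha(G)=\sum_v d_G(v)^\alpha$ (exponent on degrees), $M_1=M_1^2$, $F=M_1^3$, $M_1^4(G)=\sum_v d_G(v)^4$; $M_2(G)=\sum_{uv\in E(G)}d_G(u)d_G(v)$. For an edge $e=uv$, $d_G(e)=d_G(u)+d_G(v)-2$; $EM_2(G)=\sum_{e\sim f}d_G(e)d_G(f)$, the sum over unordered pairs of distinct edges sharing a vertex. -}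

module Defs where

open import Data.Empty using (⊥)
open import Data.Fin as Fin using (Fin)
open import Data.Fin.Properties as Fin using (any?; injective⇒≤)
import Data.Integer as ℤ
open import Data.List using (List; []; _∷_; _++_; map; filter; length; allFin; cartesianProduct)
open import Data.Nat using (ℕ; zero; suc; _+_; _*_; _∸_; _^_; _≤_; _<_; _≤?_; s≤s)
open import Data.Nat.ListAction using (sum)
open import Data.Nat.Properties using (≮⇒≥; m<1+n⇒m<n∨m≡n)
open import Data.Product using (∃; _×_; _,_; proj₁; proj₂)
open import Data.Rational using (ℚ)
open import Data.Rational.Literals using (fromℤ)
open import Data.Sum using (_⊎_; inj₁; inj₂)
open import Data.Vec using (Vec; []; _∷_; _∷ʳ_)
open import Data.Vec.Relation.Unary.AllPairs using (AllPairs; allPairs?)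
open import Data.Vec.Relation.Unary.Linked using (Linked; linked?)
open import Data.Vec.Relation.Unary.Unique.Propositional using (Unique)
open import Data.Vec.Relation.Unary.Unique.Propositional.Properties using (lookup-injective)
open import Function using (_∘_)
open import Level using (0ℓ)
open import Relation.Binary using (Rel; Decidable; Symmetric; Irreflexive)
open import Relation.Binary.Construct.Add.Supremum.NonStrict _≤_ public using (_≤⁺_; [_]; _≤⊤⁺)
open import Relation.Binary.PropositionalEquality using (_≡_; refl)
open import Relation.Nullary using (¬_; Dec; yes; no; ¬?; _×-dec_; _⊎-dec_)
open import Relation.Nullary.Construct.Add.Supremum public using (_⁺; [_]; ⊤⁺)
open import Relation.Nullary.Decidable using (map′)

record Graph : Set₁ where
  infix 4 _~_ _~?_
  field
    order    : ℕ
    _~_      : Rel (Fin order) 0ℓ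
    _~?_     : Decidable _~_
    ~-sym    : Symmetric _~_
    ~-irrefl : Irreflexive _≡_ _~_

  Vertex : Set
  Vertex = Fin order

  vertices : List Vertex
  vertices = allFin order

  -- The edge {u, v} is represented by the pair (u , v) with u < v, so that it
  -- is listed exactly once in `edges`.
  Edge : Set
  Edge = Vertex × Vertex

  edges : List Edge
  edges = filter (λ (u , v) → (u Fin.<? v) ×-dec (u ~? v)) (cartesianProduct vertices vertices)

  size : ℕ
  size = length edges

  degree : Vertex → ℕ
  degree v = length (filter (v ~?_) vertices)

  -- On edges the subtraction never truncates: both endpoints have degree ≥ 1.
  edgeDegree : Edge → ℕ
  edgeDegree (u , v) = degree u + degree v ∸ 2

  _∈ₑ_ : Vertex → Edge → Set
  w ∈ₑ (u , v) = w ≡ u ⊎ w ≡ v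

  SharesVertex : Rel Edge 0ℓ
  SharesVertex e f = ∃ λ w → w ∈ₑ e × w ∈ₑ f

  Disjoint : Rel Edge 0ℓ
  Disjoint e f = ¬ SharesVertex e f

  _∈ₑ?_ : Decidable _∈ₑ_
  w ∈ₑ? (u , v) = (w Fin.≟ u) ⊎-dec (w Fin.≟ v)

  sharesVertex? : Decidable SharesVertex
  sharesVertex? e f = any? λ w → (w ∈ₑ? e) ×-dec (w ∈ₑ? f)

  disjoint? : Decidable Disjoint
  disjoint? e f = ¬? (sharesVertex? e f)

  -- A cycle of length k, given by its k distinct vertices in cyclic order.
  IsCycle : ∀ {k} → Vec Vertex k → Set
  IsCycle []             = ⊥
  IsCycle {k} c@(v ∷ vs) = 3 ≤ k × Unique c × Linked _~_ (c ∷ʳ v)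

  HasCycle : ℕ → Set
  HasCycle k = ∃ λ (c : Vec Vertex k) → IsCycle c

  IsGirth : ℕ ⁺ → Set
  IsGirth ⊤⁺    = ∀ k → ¬ HasCycle k
  IsGirth [ g ] = HasCycle g × (∀ k → HasCycle k → g ≤ k)

open Graph

-- The k-element sublists of a list, each position subset occurring once.  For
-- a list without repetitions these represent its k-element subsets.
combinations : ∀ {A : Set} k → List A → List (Vec A k)
combinations zero    xs       = [] ∷ []
combinations (suc k) []       = []
combinations (suc k) (x ∷ xs) = map (x ∷_) (combinations k xs) ++ combinations (suc k) xs

private
  anyVec? : ∀ {n} k {P : Vec (Fin n) k → Set} → (∀ c → Dec (P c)) → Dec (∃ P)
  anyVec? zero    P? = map′ ([] ,_) (λ { ([] , p) → p }) (P? [])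
  anyVec? (suc k) P? =
    map′ (λ (v , c , p) → v ∷ c , p) (λ { (v ∷ c , p) → v , c , p })
         (any? λ v → anyVec? k λ c → P? (v ∷ c))

  least : {P : ℕ → Set} → (∀ k → Dec (P k)) → ∀ N →
          (∃ λ g → P g × (∀ k → P k → g ≤ k)) ⊎ (∀ k → k < N → ¬ P k)
  least P? zero    = inj₂ λ _ ()
  least P? (suc N) with least P? N
  ... | inj₁ found = inj₁ found
  ... | inj₂ none  with P? N
  ...   | yes p = inj₁ (N , p , λ k q → ≮⇒≥ λ k<N → none k k<N q)
  ...   | no ¬p = inj₂ λ k k<1+N q → case (m<1+n⇒m<n∨m≡n k<1+N) q
    where
    case : ∀ {k} → k < N ⊎ k ≡ N → ¬ _
    case (inj₁ k<N)  q = none _ k<N q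
    case (inj₂ refl) q = ¬p q

isCycle? : ∀ G {k} (c : Vec (Vertex G) k) → Dec (IsCycle G c)
isCycle? G []           = no λ ()
isCycle? G {k} (v ∷ vs) =
  (3 ≤? k) ×-dec allPairs? (λ x y → ¬? (x Fin.≟ y)) (v ∷ vs) ×-dec linked? (_~?_ G) ((v ∷ vs) ∷ʳ v)

hasCycle? : ∀ G k → Dec (HasCycle G k)
hasCycle? G k = anyVec? k (isCycle? G)

cycle-length≤order : ∀ G {k} → HasCycle G k → k ≤ order G
cycle-length≤order G (_ ∷ _ , _ , unique , _) =
  injective⇒≤ λ {i} {j} → lookup-injective unique i j

hasGirth : ∀ G → ∃ (IsGirth G)
hasGirth G with least (hasCycle? G) (suc (order G))
... | inj₁ (g , isLeast) = [ g ] , isLeast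
... | inj₂ none          = ⊤⁺ , λ k c → none k (s≤s (cycle-length≤order G c)) c

girth : Graph → ℕ ⁺
girth = proj₁ ∘ hasGirth

girth-isGirth : ∀ G → IsGirth G (girth G)
girth-isGirth = proj₂ ∘ hasGirth

matchings : ∀ G k → List (Vec (Edge G) k)
matchings G k = filter (allPairs? (disjoint? G)) (combinations k (edges G))

p : Graph → ℕ → ℕ
p G k = length (matchings G k)

M₁^ : ℕ → Graph → ℕ
M₁^ α G = sum (map (λ v → degree G v ^ α) (vertices G))

M₁ : Graph → ℕ
M₁ = M₁^ 2

F : Graph → ℕ
F = M₁^ 3

M₂ : Graph → ℕ
M₂ G = sum (map (λ (u , v) → degree G u * degree G v) (edges G))

adjacentEdges : ∀ G → List (Edge G × Edge G)
adjacentEdges G =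
  filter (λ (e , f) → sharesVertex? G e f)
         (map (λ { (e ∷ f ∷ []) → e , f }) (combinations 2 (edges G)))

EM₂ : Graph → ℕ
EM₂ G = sum (map (λ (e , f) → edgeDegree G e * edgeDegree G f) (adjacentEdges G))

fromℕ : ℕ → ℚ
fromℕ n = fromℤ (ℤ.+ n)

{-# OPTIONS --safe #-}

-- Write S for the 0/1 matrix on edges recording whether two edges meet (with
-- S e e = 1), D = 1 − S, and s, c, t for the row sums of S, the entries of S²
-- and the diagonal of S³.  Then 24 p(G;4) is the sum over ordered quadruples of
-- edges of the product of D over all pairs.  An edge has two ends, so it cannot
-- meet three pairwise disjoint edges; expanding the sum over the fourth edge
-- therefore leaves only s and c.  The sum over the third edge is again
-- expressed by s and c, and D c² = D c, since without triangles and 4-cycles at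
-- most one edge joins two disjoint edges.  What remains are sums over single
-- edges e = uv of polynomials in s e = d(u) + d(v) − 1, in (S s) e, which brings in
-- EM₂, and in t e = d(u)² + d(v)² − 1, as pairwise meeting edges of a
-- triangle-free graph have a common vertex.  Finally, the sum over edges of
-- φ(u) + φ(v) is the sum over vertices of d(v) φ(v).

module Submission where

open import Defs

-- After multiplication by 24 the claim is an identity in ℤ, where the ring solver settles every
-- rearrangement; denominators enter only at the very end. The elimination of edges rests on
-- symmetry. Summing over the fourth edge `h` leaves the bracket `N - s e - s f - s g + c e f + c e
-- g + c f g`, which still involves all of `e`, `f`, `g`. The product of the three `D` in front of
-- it is invariant under permutations, so under the triple sum the bracket may be replaced by
-- `N - 3 s e + 3 c e f`, which is free of `g`. The sum over `g` then meets only `D e g * D f g` and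
-- gives `N - s e - s f + c e f`. The product of these two brackets is quadratic in `c`, and a sum
-- of `D c²` is not expressible by row sums of powers of `S`; the girth turns it into a sum of
-- `D c`.

module IntegerIdentity where

  open import Data.Bool using (if_then_else_)
  open import Data.Fin as Fin using (Fin)
  import Data.Fin.Properties as Fin
  open import Data.Integer using (ℤ; +_; -_; _+_; _-_; _*_; _⊖_; 0ℤ; 1ℤ)
  open import Data.Integer.Properties
  open import Data.Integer.Tactic.RingSolver using (solve-∀)
  open import Data.List using (List; []; _∷_; _++_; map; filter; length; allFin; cartesianProduct)
  open import Data.List.Membership.Propositional using (_∈_)
  open import Data.List.Membership.Propositional.Properties using (∈-allFin; ∈-filter⁺; ∈-filter⁻)
  open import Data.List.Relation.Unary.All as All using (All)
  open import Data.List.Relation.Unary.AllPairs using ([]; _∷_)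
  open import Data.List.Relation.Unary.Any using (here; there)
  open import Data.List.Relation.Unary.Unique.Propositional using (Unique)
  open import Data.List.Relation.Unary.Unique.Propositional.Properties as Unique using (allFin⁺)
  open import Data.Nat as ℕ using (ℕ; zero; suc; _^_; _!; s≤s; z≤n)
  open import Data.Nat.ListAction using (sum)
  import Data.Nat.Properties as ℕ
  open import Data.Product using (_×_; _,_; proj₁; proj₂)
  open import Data.Sum as Sum using (_⊎_; inj₁; inj₂)
  open import Data.Vec using (Vec; []; _∷_)
  open import Data.Vec.Relation.Unary.All as VecAll using ([]; _∷_)
  open import Data.Vec.Relation.Unary.AllPairs using (allPairs?; []; _∷_)
  open import Data.Vec.Relation.Unary.Linked using ([-]; _∷_)
  open import Level using (0ℓ)
  open import Relation.Binary using (Decidable; Rel; Tri; tri<; tri≈; tri>)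
  open import Relation.Binary.PropositionalEquality
  open import Relation.Nullary using (¬_; Dec; does; yes; no; ¬?; _×-dec_; _⊎-dec_; contradiction)
  import Relation.Unary as U
  open ≡-Reasoning

  -- Finite sums and indicators

  private
    variable
      A B : Set
      P Q R : Set

  ⟦_⟧ : Dec P → ℤ
  ⟦ d ⟧ = if does d then 1ℤ else 0ℤ

  ⟦⟧-true : (d : Dec P) → P → ⟦ d ⟧ ≡ 1ℤ
  ⟦⟧-true (yes _) _ = refl
  ⟦⟧-true (no ¬p) p = contradiction p ¬p

  ⟦⟧-false : (d : Dec P) → ¬ P → ⟦ d ⟧ ≡ 0ℤ
  ⟦⟧-false (yes p) ¬p = contradiction p ¬p
  ⟦⟧-false (no _)  _  = refl

  ⟦⟧-cong : (d : Dec P) (d′ : Dec Q) → (P → Q) → (Q → P) → ⟦ d ⟧ ≡ ⟦ d′ ⟧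
  ⟦⟧-cong (yes p) d′ to from = sym (⟦⟧-true d′ (to p))
  ⟦⟧-cong (no ¬p) d′ to from = sym (⟦⟧-false d′ λ q → ¬p (from q))

  ⟦⟧-× : (d : Dec P) (d′ : Dec Q) → ⟦ d ×-dec d′ ⟧ ≡ ⟦ d ⟧ * ⟦ d′ ⟧
  ⟦⟧-× (yes _) (yes _) = refl
  ⟦⟧-× (yes _) (no _)  = refl
  ⟦⟧-× (no _)  (yes _) = refl
  ⟦⟧-× (no _)  (no _)  = refl

  ⟦⟧-¬ : (d : Dec P) → ⟦ ¬? d ⟧ ≡ 1ℤ - ⟦ d ⟧
  ⟦⟧-¬ (yes _) = refl
  ⟦⟧-¬ (no _)  = refl

  -- `R` is kept abstract, with its own decision procedure, so that the lemma covers statements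
  -- merely equivalent to a disjunction, such as sharing a vertex with an edge of two given ends.
  ⟦⟧-inclusion-exclusion : (p : Dec P) (q : Dec Q) (r : Dec R) → (P → R) → (Q → R) → (R → P ⊎ Q) →
                           ⟦ r ⟧ ≡ ⟦ p ⟧ + ⟦ q ⟧ - ⟦ p ⟧ * ⟦ q ⟧
  ⟦⟧-inclusion-exclusion (yes p) (yes _) r l _ _ = ⟦⟧-true r (l p)
  ⟦⟧-inclusion-exclusion (yes p) (no _)  r l _ _ = ⟦⟧-true r (l p)
  ⟦⟧-inclusion-exclusion (no _)  (yes q) r _ m _ = ⟦⟧-true r (m q)
  ⟦⟧-inclusion-exclusion (no ¬p) (no ¬q) r _ _ n = ⟦⟧-false r λ z → Sum.[ ¬p , ¬q ] (n z)

  -- The bracketing into two triples is that of the one term to be cancelled: three disjointness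
  -- factors times three intersection factors.
  ⟦⟧-exclusive : ∀ {P₁ P₂ P₃ P₄ P₅ P₆ : Set}
    (d₁ : Dec P₁) (d₂ : Dec P₂) (d₃ : Dec P₃) (d₄ : Dec P₄) (d₅ : Dec P₅) (d₆ : Dec P₆) →
    (P₁ → P₂ → P₃ → P₄ → P₅ → ¬ P₆) →
    ⟦ d₁ ⟧ * ⟦ d₂ ⟧ * ⟦ d₃ ⟧ * (⟦ d₄ ⟧ * ⟦ d₅ ⟧ * ⟦ d₆ ⟧) ≡ 0ℤ
  ⟦⟧-exclusive (yes a) (yes b) (yes c) (yes d) (yes e) f ex =
    cong (λ z → 1ℤ * (1ℤ * z)) (⟦⟧-false f (ex a b c d e))
  ⟦⟧-exclusive (no _)  _       _       _       _      _ _ = refl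
  ⟦⟧-exclusive (yes _) (no _)  _       _       _      _ _ = refl
  ⟦⟧-exclusive (yes _) (yes _) (no _)  _       _      _ _ = refl
  ⟦⟧-exclusive (yes _) (yes _) (yes _) (no _)  _      _ _ = refl
  ⟦⟧-exclusive (yes _) (yes _) (yes _) (yes _) (no _) _ _ = refl

  ∑ : List A → (A → ℤ) → ℤ
  ∑ []       f = 0ℤ
  ∑ (x ∷ xs) f = f x + ∑ xs f

  infixr 8 ∑
  syntax ∑ xs (λ x → t) = ∑[ x ← xs ] t

  ∑-cong-∈ : ∀ (xs : List A) {f g : A → ℤ} → (∀ x → x ∈ xs → f x ≡ g x) → ∑ xs f ≡ ∑ xs g
  ∑-cong-∈ []       eq = refl
  ∑-cong-∈ (x ∷ xs) eq = cong₂ _+_ (eq x (here refl)) (∑-cong-∈ xs λ y y∈ → eq y (there y∈))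

  ∑-cong : ∀ (xs : List A) {f g : A → ℤ} → (∀ x → f x ≡ g x) → ∑ xs f ≡ ∑ xs g
  ∑-cong xs eq = ∑-cong-∈ xs λ x _ → eq x

  ∑-zero : ∀ (xs : List A) → ∑[ x ← xs ] 0ℤ ≡ 0ℤ
  ∑-zero []       = refl
  ∑-zero (x ∷ xs) = trans (+-identityˡ _) (∑-zero xs)

  ∑-+ : ∀ (xs : List A) (f g : A → ℤ) → ∑[ x ← xs ] (f x + g x) ≡ ∑ xs f + ∑ xs g
  ∑-+ []       f g = refl
  ∑-+ (x ∷ xs) f g = trans (cong (_+_ (f x + g x)) (∑-+ xs f g)) (interchange (f x) (g x) _ _)
    where
    interchange : ∀ a b c d → (a + b) + (c + d) ≡ (a + c) + (b + d)
    interchange = solve-∀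

  ∑-*ˡ : ∀ (xs : List A) k (f : A → ℤ) → ∑[ x ← xs ] (k * f x) ≡ k * ∑ xs f
  ∑-*ˡ []       k f = sym (*-zeroʳ k)
  ∑-*ˡ (x ∷ xs) k f = trans (cong (_+_ (k * f x)) (∑-*ˡ xs k f)) (sym (*-distribˡ-+ k (f x) (∑ xs f)))

  ∑-*ʳ : ∀ (xs : List A) (f : A → ℤ) k → ∑[ x ← xs ] (f x * k) ≡ ∑ xs f * k
  ∑-*ʳ xs f k = begin
    ∑[ x ← xs ] (f x * k) ≡⟨ ∑-cong xs (λ x → *-comm (f x) k) ⟩
    ∑[ x ← xs ] (k * f x) ≡⟨ ∑-*ˡ xs k f ⟩
    k * ∑ xs f            ≡⟨ *-comm k _ ⟩
    ∑ xs f * k            ∎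

  -- Linear manipulations of sums are written k₁ * a₁ + (k₂ * a₂ + (… + 0ℤ)),
  -- with coefficients 1ℤ spelled out, to agree definitionally with `combine`.
  combine : List (ℤ × (A → ℤ)) → A → ℤ
  combine []             x = 0ℤ
  combine ((k , f) ∷ ts) x = k * f x + combine ts x

  combine∑ : List A → List (ℤ × (A → ℤ)) → ℤ
  combine∑ xs []             = 0ℤ
  combine∑ xs ((k , f) ∷ ts) = k * ∑ xs f + combine∑ xs ts

  ∑-linear : ∀ (xs : List A) ts → ∑ xs (combine ts) ≡ combine∑ xs ts
  ∑-linear xs []             = ∑-zero xs
  ∑-linear xs ((k , f) ∷ ts) = trans (∑-+ xs _ _) (cong₂ _+_ (∑-*ˡ xs k f) (∑-linear xs ts))

  ∑-swap : ∀ (xs : List A) (ys : List B) (f : A → B → ℤ) →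
           ∑[ x ← xs ] ∑[ y ← ys ] f x y ≡ ∑[ y ← ys ] ∑[ x ← xs ] f x y
  ∑-swap []       ys f = sym (∑-zero ys)
  ∑-swap (x ∷ xs) ys f = trans (cong (_+_ (∑ ys (f x))) (∑-swap xs ys f)) (sym (∑-+ ys (f x) _))

  ∑-++ : ∀ (xs ys : List A) (f : A → ℤ) → ∑ (xs ++ ys) f ≡ ∑ xs f + ∑ ys f
  ∑-++ []       ys f = sym (+-identityˡ _)
  ∑-++ (x ∷ xs) ys f = trans (cong (_+_ (f x)) (∑-++ xs ys f)) (sym (+-assoc (f x) _ _))

  ∑-map : ∀ (xs : List A) (g : A → B) (f : B → ℤ) → ∑ (map g xs) f ≡ ∑[ x ← xs ] f (g x)
  ∑-map []       g f = refl
  ∑-map (x ∷ xs) g f = cong (_+_ (f (g x))) (∑-map xs g f)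

  ∑-cartesianProduct : ∀ (xs : List A) (ys : List B) (f : A × B → ℤ) →
    ∑ (cartesianProduct xs ys) f ≡ ∑[ x ← xs ] ∑[ y ← ys ] f (x , y)
  ∑-cartesianProduct []       ys f = refl
  ∑-cartesianProduct (x ∷ xs) ys f =
    trans (∑-++ (map (x ,_) ys) _ f)
          (cong₂ _+_ (∑-map ys (x ,_) f) (∑-cartesianProduct xs ys f))

  ∑-filter : ∀ {P : A → Set} (P? : U.Decidable P) (xs : List A) (f : A → ℤ) →
             ∑ (filter P? xs) f ≡ ∑[ x ← xs ] (⟦ P? x ⟧ * f x)
  ∑-filter P? []       f = refl
  ∑-filter P? (x ∷ xs) f with P? x
  ... | yes _ = cong₂ _+_ (sym (*-identityˡ (f x))) (∑-filter P? xs f)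
  ... | no _  = trans (∑-filter P? xs f) (sym (+-identityˡ _))

  +-length : ∀ (xs : List A) → + length xs ≡ ∑[ x ← xs ] 1ℤ
  +-length []       = refl
  +-length (x ∷ xs) = cong (λ z → 1ℤ + z) (+-length xs)

  +-sum-map : ∀ (xs : List A) (f : A → ℕ) → + sum (map f xs) ≡ ∑[ x ← xs ] (+ f x)
  +-sum-map []       f = refl
  +-sum-map (x ∷ xs) f = cong (_+_ (+ f x)) (+-sum-map xs f)

  +-length-filter : ∀ {P : A → Set} (P? : U.Decidable P) (xs : List A) →
                    + length (filter P? xs) ≡ ∑[ x ← xs ] ⟦ P? x ⟧
  +-length-filter P? xs = begin
    + length (filter P? xs)         ≡⟨ +-length (filter P? xs) ⟩
    ∑[ x ← filter P? xs ] 1ℤ        ≡⟨ ∑-filter P? xs _ ⟩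
    ∑[ x ← xs ] (⟦ P? x ⟧ * 1ℤ)     ≡⟨ ∑-cong xs (λ x → *-identityʳ ⟦ P? x ⟧) ⟩
    ∑[ x ← xs ] ⟦ P? x ⟧            ∎

  ∑-false : ∀ {P : A → Set} (P? : U.Decidable P) xs → (∀ x → x ∈ xs → ¬ P x) → ∑[ x ← xs ] ⟦ P? x ⟧ ≡ 0ℤ
  ∑-false P? xs none = trans (∑-cong-∈ xs λ x x∈ → ⟦⟧-false (P? x) (none x x∈)) (∑-zero xs)

  ∑-unique : ∀ {P : A → Set} (P? : U.Decidable P) {xs} {y} → Unique xs → y ∈ xs → P y →
             (∀ x → x ∈ xs → P x → y ≡ x) → ∑[ x ← xs ] ⟦ P? x ⟧ ≡ 1ℤ
  ∑-unique P? {x ∷ xs} (x∉ ∷ _) (here refl) py only =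
    cong₂ _+_ (⟦⟧-true (P? x) py)
      (∑-false P? xs λ z z∈ pz → All.lookup x∉ z∈ (only z (there z∈) pz))
  ∑-unique P? {x ∷ xs} (x∉ ∷ uniq) (there y∈) py only =
    cong₂ _+_ (⟦⟧-false (P? x) λ px → All.lookup x∉ y∈ (sym (only x (here refl) px)))
      (∑-unique P? uniq y∈ py λ z z∈ → only z (there z∈))

  -- At most one summand is nonzero, so the sum is 0 or 1. Idempotence expresses this without a case
  -- distinction and is the form in which a square of `c` gets removed.
  ∑-idempotent : ∀ {P : A → Set} (P? : U.Decidable P) {xs} → Unique xs →
                 (∀ x y → x ∈ xs → y ∈ xs → P x → P y → x ≡ y) →
                 (∑[ x ← xs ] ⟦ P? x ⟧) * (∑[ x ← xs ] ⟦ P? x ⟧) ≡ ∑[ x ← xs ] ⟦ P? x ⟧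
  ∑-idempotent P? {[]}     _              _    = refl
  ∑-idempotent P? {x ∷ xs} (x∉ ∷ uniq) only with P? x
  ... | yes px = trans (cong (λ z → (1ℤ + z) * (1ℤ + z)) rest≡0) (cong (_+_ 1ℤ) (sym rest≡0))
    where
    rest≡0 = ∑-false P? xs λ y y∈ py → All.lookup x∉ y∈ (only x y (here refl) (there y∈) px py)
  ... | no _ = trans (cong (λ z → z * z) (+-identityˡ rest)) (trans rest-idem (sym (+-identityˡ rest)))
    where
    rest = ∑[ y ← xs ] ⟦ P? y ⟧
    rest-idem : rest * rest ≡ rest
    rest-idem = ∑-idempotent P? uniq λ y z y∈ z∈ → only y z (there y∈) (there z∈)

  ∑-allFin-δ : ∀ {n} (w : Fin n) (f : Fin n → ℤ) → ∑[ x ← allFin n ] (⟦ w Fin.≟ x ⟧ * f x) ≡ f w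
  ∑-allFin-δ {n} w f = begin
    ∑[ x ← allFin n ] (⟦ w Fin.≟ x ⟧ * f x) ≡⟨ ∑-cong (allFin n) at-w ⟩
    ∑[ x ← allFin n ] (⟦ w Fin.≟ x ⟧ * f w) ≡⟨ ∑-*ʳ (allFin n) _ (f w) ⟩
    (∑[ x ← allFin n ] ⟦ w Fin.≟ x ⟧) * f w ≡⟨ cong (_* f w) unique-w ⟩
    1ℤ * f w                                ≡⟨ *-identityˡ (f w) ⟩
    f w                                     ∎
    where
    unique-w = ∑-unique (w Fin.≟_) (allFin⁺ n) (∈-allFin w) refl λ _ _ w≡x → w≡x
    at-w : ∀ x → ⟦ w Fin.≟ x ⟧ * f x ≡ ⟦ w Fin.≟ x ⟧ * f w
    at-w x with w Fin.≟ x
    ... | yes refl = refl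
    ... | no _     = refl

  -- Unordered and ordered tuples of pairwise related elements

  module Counting {A : Set} {R : Rel A 0ℓ} (R? : Decidable R) where

    D : A → A → ℤ
    D x y = ⟦ R? x y ⟧

    infixl 7 _⊙_
    _⊙_ : (A → ℤ) → A → A → ℤ
    (φ ⊙ x) y = φ y * D x y

    -- The weight φ carries the constraints imposed by the elements chosen so far.
    unordered : ℕ → (A → ℤ) → List A → ℤ
    unordered zero    φ xs       = 1ℤ
    unordered (suc k) φ []       = 0ℤ
    unordered (suc k) φ (x ∷ xs) = φ x * unordered k (φ ⊙ x) xs + unordered (suc k) φ xs

    -- Each choice ranges over all of `xs` again, not only over later entries; repeated choices are
    -- cancelled by the factor `D x x` once `D` vanishes on the diagonal.
    ordered : ℕ → (A → ℤ) → List A → ℤ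
    ordered zero    φ xs = 1ℤ
    ordered (suc k) φ xs = ∑[ x ← xs ] (φ x * ordered k (φ ⊙ x) xs)

    unordered-cong : ∀ k {φ ψ} → (∀ x → φ x ≡ ψ x) → ∀ xs → unordered k φ xs ≡ unordered k ψ xs
    unordered-cong zero    eq xs       = refl
    unordered-cong (suc k) eq []       = refl
    unordered-cong (suc k) eq (x ∷ xs) =
      cong₂ _+_ (cong₂ _*_ (eq x) (unordered-cong k (λ y → cong (_* D x y) (eq y)) xs))
                (unordered-cong (suc k) eq xs)

    weight : ∀ {k} → (A → ℤ) → Vec A k → ℤ
    weight φ []       = 1ℤ
    weight φ (x ∷ xs) = φ x * weight φ xs

    weight-⊙ : ∀ {k} φ x (c : Vec A k) → ⟦ VecAll.all? (R? x) c ⟧ * weight φ c ≡ weight (φ ⊙ x) c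
    weight-⊙ φ x []      = refl
    weight-⊙ φ x (y ∷ c) = begin
      ⟦ VecAll.all? (R? x) (y ∷ c) ⟧ * (φ y * weight φ c)
        ≡⟨ cong (_* (φ y * weight φ c)) (⟦⟧-× (R? x y) (VecAll.all? (R? x) c)) ⟩
      (D x y * ⟦ VecAll.all? (R? x) c ⟧) * (φ y * weight φ c)
        ≡⟨ rearrange (D x y) _ (φ y) _ ⟩
      (φ y * D x y) * (⟦ VecAll.all? (R? x) c ⟧ * weight φ c)
        ≡⟨ cong ((φ y * D x y) *_) (weight-⊙ φ x c) ⟩
      weight (φ ⊙ x) (y ∷ c) ∎
      where
      rearrange : ∀ a b c d → (a * b) * (c * d) ≡ (c * a) * (b * d)
      rearrange = solve-∀

    -- Both sides obey the same recursion on the head of the list. A general `φ` is needed because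
    -- choosing the head turns `φ` into `φ ⊙ x`.
    ∑-combinations : ∀ k φ xs → ∑[ c ← combinations k xs ] (⟦ allPairs? R? c ⟧ * weight φ c) ≡ unordered k φ xs
    ∑-combinations zero    φ xs       = refl
    ∑-combinations (suc k) φ []       = refl
    ∑-combinations (suc k) φ (x ∷ xs) =
      trans (∑-++ (map (x ∷_) (combinations k xs)) _ _)
            (cong₂ _+_ with-x (∑-combinations (suc k) φ xs))
      where
      rearrange : ∀ a b c d → (a * b) * (c * d) ≡ c * (b * (a * d))
      rearrange = solve-∀
      step : ∀ c → ⟦ allPairs? R? (x ∷ c) ⟧ * (φ x * weight φ c) ≡
                   φ x * (⟦ allPairs? R? c ⟧ * weight (φ ⊙ x) c)
      step c = begin
        ⟦ allPairs? R? (x ∷ c) ⟧ * (φ x * weight φ c)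
          ≡⟨ cong (_* (φ x * weight φ c)) (⟦⟧-× (VecAll.all? (R? x) c) (allPairs? R? c)) ⟩
        (⟦ VecAll.all? (R? x) c ⟧ * ⟦ allPairs? R? c ⟧) * (φ x * weight φ c)
          ≡⟨ rearrange ⟦ VecAll.all? (R? x) c ⟧ _ (φ x) _ ⟩
        φ x * (⟦ allPairs? R? c ⟧ * (⟦ VecAll.all? (R? x) c ⟧ * weight φ c))
          ≡⟨ cong (λ z → φ x * (⟦ allPairs? R? c ⟧ * z)) (weight-⊙ φ x c) ⟩
        φ x * (⟦ allPairs? R? c ⟧ * weight (φ ⊙ x) c) ∎
      with-x : ∑[ c ← map (x ∷_) (combinations k xs) ] (⟦ allPairs? R? c ⟧ * weight φ c) ≡
               φ x * unordered k (φ ⊙ x) xs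
      with-x = begin
        ∑[ c ← map (x ∷_) (combinations k xs) ] (⟦ allPairs? R? c ⟧ * weight φ c)
          ≡⟨ ∑-map (combinations k xs) (x ∷_) _ ⟩
        ∑[ c ← combinations k xs ] (⟦ allPairs? R? (x ∷ c) ⟧ * (φ x * weight φ c))
          ≡⟨ ∑-cong (combinations k xs) step ⟩
        ∑[ c ← combinations k xs ] (φ x * (⟦ allPairs? R? c ⟧ * weight (φ ⊙ x) c))
          ≡⟨ ∑-*ˡ (combinations k xs) (φ x) _ ⟩
        φ x * ∑[ c ← combinations k xs ] (⟦ allPairs? R? c ⟧ * weight (φ ⊙ x) c)
          ≡⟨ cong (φ x *_) (∑-combinations k (φ ⊙ x) xs) ⟩
        φ x * unordered k (φ ⊙ x) xs ∎

    module _ (D-sym : ∀ x y → D x y ≡ D y x) (D-irrefl : ∀ x → D x x ≡ 0ℤ) where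

      ⊙-swap : ∀ φ x y z → (φ ⊙ x ⊙ y) z ≡ (φ ⊙ y ⊙ x) z
      ⊙-swap φ x y z = swap (φ z) (D x z) (D y z)
        where
        swap : ∀ a b c → (a * b) * c ≡ (a * c) * b
        swap = solve-∀

      -- Under `φ ⊙ x` the element `x` has weight `φ x * D x x`, which is 0.
      drop-self : ∀ k φ x xs → unordered k (φ ⊙ x) (x ∷ xs) ≡ unordered k (φ ⊙ x) xs
      drop-self zero    φ x xs = refl
      drop-self (suc k) φ x xs =
        trans (cong (λ z → φ x * z * unordered k (φ ⊙ x ⊙ x) xs + unordered (suc k) (φ ⊙ x) xs) (D-irrefl x))
              (vanish (φ x) _ _)
        where
        vanish : ∀ a b c → a * 0ℤ * b + c ≡ c
        vanish = solve-∀

      -- Double counting: a selection of `suc k` elements arises once for each of its members taken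
      -- as the distinguished one.
      suc-unordered : ∀ k φ xs →
        + suc k * unordered (suc k) φ xs ≡ ∑[ x ← xs ] (φ x * unordered k (φ ⊙ x) xs)
      suc-unordered k       φ []       = *-zeroʳ (+ suc k)
      suc-unordered zero    φ (x ∷ xs) = trans (single (φ x) _) (cong (_+_ (φ x * 1ℤ)) (suc-unordered zero φ xs))
        where
        single : ∀ a b → 1ℤ * (a * 1ℤ + b) ≡ a * 1ℤ + 1ℤ * b
        single = solve-∀
      suc-unordered (suc k) φ (x ∷ xs) = sym (begin
        φ x * unordered (suc k) (φ ⊙ x) (x ∷ xs) + ∑[ y ← xs ] (φ y * unordered (suc k) (φ ⊙ y) (x ∷ xs))
          ≡⟨ cong₂ _+_ (cong (φ x *_) (drop-self (suc k) φ x xs)) (trans (∑-cong xs split) (∑-+ xs _ _)) ⟩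
        -- The three contributions: the head `x` is distinguished; `x` is selected but another
        -- element `y` is distinguished; `x` is not selected.
        φ x * e + (∑[ y ← xs ] (φ x * ((φ ⊙ x) y * unordered k (φ ⊙ x ⊙ y) xs))
                    + ∑[ y ← xs ] (φ y * unordered (suc k) (φ ⊙ y) xs))
          ≡⟨ cong (_+_ (φ x * e)) (cong₂ _+_
               (trans (∑-*ˡ xs (φ x) _) (cong (φ x *_) (sym (suc-unordered k (φ ⊙ x) xs))))
               (sym (suc-unordered (suc k) φ xs))) ⟩
        φ x * e + (φ x * (+ suc k * e) + + suc (suc k) * unordered (suc (suc k)) φ xs)
          ≡⟨ collect (φ x) e (+ suc k) _ ⟩
        + suc (suc k) * (φ x * e + unordered (suc (suc k)) φ xs) ∎)
        where
        e = unordered (suc k) (φ ⊙ x) xs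
        collect : ∀ a b n c → a * b + (a * (n * b) + (1ℤ + n) * c) ≡ (1ℤ + n) * (a * b + c)
        collect = solve-∀
        rearrange : ∀ a b c d e → a * (b * c * d + e) ≡ b * ((a * c) * d) + a * e
        rearrange = solve-∀
        split : ∀ y → φ y * unordered (suc k) (φ ⊙ y) (x ∷ xs) ≡
          φ x * ((φ ⊙ x) y * unordered k (φ ⊙ x ⊙ y) xs) + φ y * unordered (suc k) (φ ⊙ y) xs
        split y = begin
          φ y * (φ x * D y x * unordered k (φ ⊙ y ⊙ x) xs + unordered (suc k) (φ ⊙ y) xs)
            ≡⟨ cong₂ (λ d u → φ y * (φ x * d * u + unordered (suc k) (φ ⊙ y) xs))
                 (D-sym y x) (unordered-cong k (⊙-swap φ y x) xs) ⟩
          φ y * (φ x * D x y * unordered k (φ ⊙ x ⊙ y) xs + unordered (suc k) (φ ⊙ y) xs)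
            ≡⟨ rearrange (φ y) (φ x) (D x y) _ _ ⟩
          φ x * ((φ ⊙ x) y * unordered k (φ ⊙ x ⊙ y) xs) + φ y * unordered (suc k) (φ ⊙ y) xs ∎

      !*unordered : ∀ k φ xs → + (k !) * unordered k φ xs ≡ ordered k φ xs
      !*unordered zero    φ xs = refl
      !*unordered (suc k) φ xs = begin
        + (suc k ℕ.* k !) * u                       ≡⟨ cong (_* u) (pos-* (suc k) (k !)) ⟩
        (+ suc k * + (k !)) * u                     ≡⟨ rotate (+ suc k) (+ (k !)) u ⟩
        + (k !) * (+ suc k * u)                     ≡⟨ cong (+ (k !) *_) (suc-unordered k φ xs) ⟩
        + (k !) * ∑[ x ← xs ] (φ x * unordered k (φ ⊙ x) xs)
          ≡⟨ ∑-*ˡ xs (+ (k !)) _ ⟨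
        ∑[ x ← xs ] (+ (k !) * (φ x * unordered k (φ ⊙ x) xs))
          ≡⟨ ∑-cong xs (λ x → trans (exchange (+ (k !)) (φ x) _) (cong (φ x *_) (!*unordered k (φ ⊙ x) xs))) ⟩
        ordered (suc k) φ xs ∎
        where
        u = unordered (suc k) φ xs
        rotate : ∀ a b c → (a * b) * c ≡ b * (a * c)
        rotate = solve-∀
        exchange : ∀ a b c → a * (b * c) ≡ b * (a * c)
        exchange = solve-∀

      !*count : ∀ k xs →
        + (k !) * + length (filter (allPairs? R?) (combinations k xs)) ≡ ordered k (λ _ → 1ℤ) xs
      !*count k xs = trans (cong (+ (k !) *_) (begin
        + length (filter (allPairs? R?) (combinations k xs))
          ≡⟨ +-length-filter (allPairs? R?) (combinations k xs) ⟩
        ∑[ c ← combinations k xs ] ⟦ allPairs? R? c ⟧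
          ≡⟨ ∑-cong (combinations k xs) (λ c → sym (trans (cong (⟦ allPairs? R? c ⟧ *_) (weight-1 c)) (*-identityʳ ⟦ allPairs? R? c ⟧))) ⟩
        ∑[ c ← combinations k xs ] (⟦ allPairs? R? c ⟧ * weight (λ _ → 1ℤ) c)
          ≡⟨ ∑-combinations k _ xs ⟩
        unordered k (λ _ → 1ℤ) xs ∎)) (!*unordered k _ xs)
        where
        weight-1 : ∀ {k} (c : Vec A k) → weight (λ _ → 1ℤ) c ≡ 1ℤ
        weight-1 []      = refl
        weight-1 (x ∷ c) = trans (*-identityˡ _) (weight-1 c)

  -- Symmetric sums over pairs and triples

  onPair : (A → A → B) → Vec A 2 → B
  onPair g (x ∷ y ∷ []) = g x y

  -- Off the diagonal, each unordered pair of positions is met in both orders. This links the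
  -- quadratic form of a symmetric matrix to `EM₂`, which is a sum over 2-element combinations.
  ∑-pairs : ∀ (g : A → A → ℤ) → (∀ x y → g x y ≡ g y x) → ∀ xs →
    ∑[ x ← xs ] ∑[ y ← xs ] g x y ≡ (∑[ x ← xs ] g x x) + + 2 * ∑ (combinations 2 xs) (onPair g)
  ∑-pairs g g-sym []       = refl
  ∑-pairs {A = A} g g-sym (x ∷ xs) = begin
    g x x + (∑[ y ← xs ] g x y) + (∑[ z ← xs ] (g z x + ∑[ y ← xs ] g z y))
      ≡⟨ cong (λ t → g x x + r + t) (trans (∑-+ xs _ _)
           (cong₂ _+_ (∑-cong xs λ z → g-sym z x) (∑-pairs g g-sym xs))) ⟩
    g x x + r + (r + (d + + 2 * c))
      ≡⟨ collect (g x x) r d c ⟩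
    g x x + d + + 2 * (r + c)
      ≡⟨ cong (λ t → g x x + d + + 2 * t) (trans (cong (_+ c) (sym singles))
           (sym (∑-++ (map (x ∷_) (combinations 1 xs)) _ pair))) ⟩
    g x x + d + + 2 * ∑ (combinations 2 (x ∷ xs)) pair ∎
    where
    pair : Vec A 2 → ℤ
    pair = onPair g
    r = ∑[ y ← xs ] g x y
    d = ∑[ y ← xs ] g y y
    c = ∑ (combinations 2 xs) pair
    collect : ∀ g r d c → g + r + (r + (d + + 2 * c)) ≡ g + d + + 2 * (r + c)
    collect = solve-∀
    ∑-combinations₁ : ∀ xs (f : Vec A 1 → ℤ) → ∑ (combinations 1 xs) f ≡ ∑[ y ← xs ] f (y ∷ [])
    ∑-combinations₁ []       f = refl
    ∑-combinations₁ (y ∷ ys) f = cong (_+_ (f (y ∷ []))) (∑-combinations₁ ys f)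
    singles : ∑ (map (x ∷_) (combinations 1 xs)) pair ≡ r
    singles = trans (∑-map (combinations 1 xs) (x ∷_) pair) (∑-combinations₁ xs _)

  module Triples {A : Set} (xs : List A) where

    ∑³ : (A → A → A → ℤ) → ℤ
    ∑³ f = ∑[ x ← xs ] ∑[ y ← xs ] ∑[ z ← xs ] f x y z

    ∑³-cong : ∀ {f g} → (∀ x y z → f x y z ≡ g x y z) → ∑³ f ≡ ∑³ g
    ∑³-cong eq = ∑-cong xs λ x → ∑-cong xs λ y → ∑-cong xs (eq x y)

    triples : List (A × A × A)
    triples = cartesianProduct xs (cartesianProduct xs xs)

    -- Flattening to a single sum makes linearity of `∑³` a consequence of the one-variable lemmas.
    ∑³≡∑-triples : ∀ f → ∑³ f ≡ ∑[ t ← triples ] f (proj₁ t) (proj₁ (proj₂ t)) (proj₂ (proj₂ t))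
    ∑³≡∑-triples f = sym (trans (∑-cartesianProduct xs _ _) (∑-cong xs λ x → ∑-cartesianProduct xs xs _))

    ∑³-swap₁₂ : ∀ f → ∑³ f ≡ ∑³ λ x y z → f y x z
    ∑³-swap₁₂ f = ∑-swap xs xs _

    ∑³-swap₂₃ : ∀ f → ∑³ f ≡ ∑³ λ x y z → f x z y
    ∑³-swap₂₃ f = ∑-cong xs λ x → ∑-swap xs xs _

    -- The two transpositions generate all permutations of the variables, so the three sums with `r`
    -- coincide, and so do the three with `c`. On the right `z` occurs only in `w`.
    ∑³-symmetrize : ∀ (w : A → A → A → ℤ) → (∀ x y z → w x y z ≡ w y x z) → (∀ x y z → w x y z ≡ w x z y) →
      ∀ n (r : A → ℤ) (c : A → A → ℤ) →
      ∑³ (λ x y z → w x y z * (n - r x - r y - r z + c x y + c x z + c y z)) ≡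
      ∑³ (λ x y z → w x y z * (n - + 3 * r x + + 3 * c x y))
    ∑³-symmetrize w w₁₂ w₂₃ n r c = begin
      ∑³ (λ x y z → w x y z * (n - r x - r y - r z + c x y + c x z + c y z))
        ≡⟨ ∑³-cong (λ x y z → expand (w x y z) n (r x) (r y) (r z) (c x y) (c x z) (c y z)) ⟩
      ∑³ (λ x y z → n * w x y z + (- 1ℤ * (w x y z * r x) + (- 1ℤ * (w x y z * r y) + (- 1ℤ * (w x y z * r z) +
        (1ℤ * (w x y z * c x y) + (1ℤ * (w x y z * c x z) + (1ℤ * (w x y z * c y z) + 0ℤ)))))))
        ≡⟨ ∑³-linear ((n , w) ∷ (- 1ℤ , wr₁) ∷ (- 1ℤ , wr₂) ∷ (- 1ℤ , wr₃) ∷ (1ℤ , wc₁₂) ∷ (1ℤ , wc₁₃) ∷ (1ℤ , wc₂₃) ∷ []) ⟩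
      n * ∑³ w + (- 1ℤ * ∑³ wr₁ + (- 1ℤ * ∑³ wr₂ + (- 1ℤ * ∑³ wr₃ +
        (1ℤ * ∑³ wc₁₂ + (1ℤ * ∑³ wc₁₃ + (1ℤ * ∑³ wc₂₃ + 0ℤ))))))
        ≡⟨ cong₂ (λ a b → n * ∑³ w + (- 1ℤ * ∑³ wr₁ + (- 1ℤ * a + (- 1ℤ * b +
             (1ℤ * ∑³ wc₁₂ + (1ℤ * ∑³ wc₁₃ + (1ℤ * ∑³ wc₂₃ + 0ℤ))))))) r₂ r₃ ⟩
      n * ∑³ w + (- 1ℤ * ∑³ wr₁ + (- 1ℤ * ∑³ wr₁ + (- 1ℤ * ∑³ wr₁ +
        (1ℤ * ∑³ wc₁₂ + (1ℤ * ∑³ wc₁₃ + (1ℤ * ∑³ wc₂₃ + 0ℤ))))))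
        ≡⟨ cong₂ (λ a b → n * ∑³ w + (- 1ℤ * ∑³ wr₁ + (- 1ℤ * ∑³ wr₁ + (- 1ℤ * ∑³ wr₁ +
             (1ℤ * ∑³ wc₁₂ + (1ℤ * a + (1ℤ * b + 0ℤ))))))) c₁₃ c₂₃ ⟩
      n * ∑³ w + (- 1ℤ * ∑³ wr₁ + (- 1ℤ * ∑³ wr₁ + (- 1ℤ * ∑³ wr₁ +
        (1ℤ * ∑³ wc₁₂ + (1ℤ * ∑³ wc₁₂ + (1ℤ * ∑³ wc₁₂ + 0ℤ))))))
        ≡⟨ collect n (∑³ w) (∑³ wr₁) (∑³ wc₁₂) ⟩
      n * ∑³ w + (- + 3 * ∑³ wr₁ + (+ 3 * ∑³ wc₁₂ + 0ℤ))
        ≡⟨ ∑³-linear ((n , w) ∷ (- + 3 , wr₁) ∷ (+ 3 , wc₁₂) ∷ []) ⟨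
      ∑³ (λ x y z → n * w x y z + (- + 3 * (w x y z * r x) + (+ 3 * (w x y z * c x y) + 0ℤ)))
        ≡⟨ ∑³-cong (λ x y z → contract (w x y z) n (r x) (c x y)) ⟩
      ∑³ (λ x y z → w x y z * (n - + 3 * r x + + 3 * c x y)) ∎
      where
      combine³ : List (ℤ × (A → A → A → ℤ)) → A → A → A → ℤ
      combine³ []             x y z = 0ℤ
      combine³ ((k , f) ∷ ts) x y z = k * f x y z + combine³ ts x y z
      combine∑³ : List (ℤ × (A → A → A → ℤ)) → ℤ
      combine∑³ []             = 0ℤ
      combine∑³ ((k , f) ∷ ts) = k * ∑³ f + combine∑³ ts
      ∑³-linear : ∀ ts → ∑³ (combine³ ts) ≡ combine∑³ ts
      ∑³-linear []             = trans (∑³≡∑-triples _) (∑-zero triples)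
      ∑³-linear ((k , f) ∷ ts) = trans (∑³≡∑-triples _) (trans (∑-+ triples _ _)
        (cong₂ _+_ (trans (∑-*ˡ triples k _) (cong (k *_) (sym (∑³≡∑-triples f))))
                   (trans (sym (∑³≡∑-triples (combine³ ts))) (∑³-linear ts))))
      wr₁ wr₂ wr₃ wc₁₂ wc₁₃ wc₂₃ : A → A → A → ℤ
      wr₁  x y z = w x y z * r x
      wr₂  x y z = w x y z * r y
      wr₃  x y z = w x y z * r z
      wc₁₂ x y z = w x y z * c x y
      wc₁₃ x y z = w x y z * c x z
      wc₂₃ x y z = w x y z * c y z
      r₂ : ∑³ wr₂ ≡ ∑³ wr₁
      r₂ = trans (∑³-swap₁₂ wr₂) (∑³-cong λ x y z → cong (_* r x) (w₁₂ y x z))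
      r₃ : ∑³ wr₃ ≡ ∑³ wr₁
      r₃ = trans (trans (∑³-swap₂₃ wr₃) (∑³-cong λ x y z → cong (_* r y) (w₂₃ x z y))) r₂
      c₁₃ : ∑³ wc₁₃ ≡ ∑³ wc₁₂
      c₁₃ = trans (∑³-swap₂₃ wc₁₃) (∑³-cong λ x y z → cong (_* c x y) (w₂₃ x z y))
      c₂₃ : ∑³ wc₂₃ ≡ ∑³ wc₁₂
      c₂₃ = trans (trans (∑³-swap₁₂ wc₂₃) (∑³-cong λ x y z → cong (_* c x z) (w₁₂ y x z))) c₁₃
      expand : ∀ w n a b c d e f → w * (n - a - b - c + d + e + f) ≡
        n * w + (- 1ℤ * (w * a) + (- 1ℤ * (w * b) + (- 1ℤ * (w * c) +
          (1ℤ * (w * d) + (1ℤ * (w * e) + (1ℤ * (w * f) + 0ℤ))))))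
      expand = solve-∀
      collect : ∀ n w a d → n * w + (- 1ℤ * a + (- 1ℤ * a + (- 1ℤ * a + (1ℤ * d + (1ℤ * d + (1ℤ * d + 0ℤ)))))) ≡
        n * w + (- + 3 * a + (+ 3 * d + 0ℤ))
      collect = solve-∀
      contract : ∀ w n a d → n * w + (- + 3 * (w * a) + (+ 3 * (w * d) + 0ℤ)) ≡ w * (n - + 3 * a + + 3 * d)
      contract = solve-∀

  pos-^2 : ∀ n → + (n ^ 2) ≡ + n * + n
  pos-^2 n = trans (cong (λ z → + (n ℕ.* z)) (ℕ.*-identityʳ n)) (pos-* n n)

  pos-^suc : ∀ n k → + (n ^ suc k) ≡ + n * + (n ^ k)
  pos-^suc n k = pos-* n (n ^ k)

  ∈⇒1≤length : ∀ {A : Set} {x : A} {xs} → x ∈ xs → 1 ℕ.≤ length xs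
  ∈⇒1≤length {xs = _ ∷ _} _ = s≤s z≤n

  -- A polynomial as a list of monomials k i j, so that its cast to ℚ is a single induction.
  quadratic : List (ℤ × ℤ × ℤ) → ℤ
  quadratic []                 = + 0
  quadratic ((k , i , j) ∷ ts) = k * (i * j) + quadratic ts

  -- Edges of graphs of girth at least five

  module _ (G : Graph) where
    open Graph G

    girth≤cycle : ∀ {g k} → [ g ] ≤⁺ girth G → HasCycle k → g ℕ.≤ k
    girth≤cycle {k = k} g≤ cycle with girth G | girth-isGirth G
    girth≤cycle [ g≤g′ ]    cycle | [ _ ] | _ , minimal = ℕ.≤-trans g≤g′ (minimal _ cycle)
    girth≤cycle (_ ≤⊤⁺)     cycle | ⊤⁺    | acyclic     = contradiction cycle (acyclic _)

    ~⇒≢ : ∀ {a b} → a ~ b → a ≢ b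
    ~⇒≢ a~b a≡b = ~-irrefl a≡b a~b

    triangle⇒cycle : ∀ {a b c} → a ~ b → b ~ c → c ~ a → HasCycle 3
    triangle⇒cycle {a} {b} {c} a~b b~c c~a =
      a ∷ b ∷ c ∷ [] , s≤s (s≤s (s≤s z≤n)) ,
      (~⇒≢ a~b ∷ (λ a≡c → ~⇒≢ c~a (sym a≡c)) ∷ []) ∷ (~⇒≢ b~c ∷ []) ∷ [] ∷ [] ,
      a~b ∷ b~c ∷ c~a ∷ [-]

    -- Consecutive corners differ by irreflexivity; only the two opposite pairs have to be assumed
    -- distinct.
    square⇒cycle : ∀ {a b c d} → a ≢ c → b ≢ d → a ~ b → b ~ c → c ~ d → d ~ a → HasCycle 4
    square⇒cycle {a} {b} {c} {d} a≢c b≢d a~b b~c c~d d~a =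
      a ∷ b ∷ c ∷ d ∷ [] , s≤s (s≤s (s≤s z≤n)) ,
      (~⇒≢ a~b ∷ a≢c ∷ (λ a≡d → ~⇒≢ d~a (sym a≡d)) ∷ []) ∷ (~⇒≢ b~c ∷ b≢d ∷ []) ∷ (~⇒≢ c~d ∷ []) ∷ [] ∷ [] ,
      a~b ∷ b~c ∷ c~d ∷ d~a ∷ [-]

    edges-unique : Unique edges
    edges-unique = Unique.filter⁺ _ (Unique.cartesianProduct⁺ (allFin⁺ order) (allFin⁺ order))

    edge-ordered : ∀ {u v} → (u , v) ∈ edges → u Fin.< v
    edge-ordered e∈ = proj₁ (proj₂ (∈-filter⁻ _ {xs = cartesianProduct vertices vertices} e∈))

    edge-adjacent : ∀ {u v} → (u , v) ∈ edges → u ~ v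
    edge-adjacent e∈ = proj₂ (proj₂ (∈-filter⁻ _ {xs = cartesianProduct vertices vertices} e∈))

    ∈ₑ-adjacent : ∀ {e x y} → e ∈ edges → x ∈ₑ e → y ∈ₑ e → x ≢ y → x ~ y
    ∈ₑ-adjacent e∈ (inj₁ refl) (inj₁ refl) x≢y = contradiction refl x≢y
    ∈ₑ-adjacent e∈ (inj₁ refl) (inj₂ refl) x≢y = edge-adjacent e∈
    ∈ₑ-adjacent e∈ (inj₂ refl) (inj₁ refl) x≢y = ~-sym (edge-adjacent e∈)
    ∈ₑ-adjacent e∈ (inj₂ refl) (inj₂ refl) x≢y = contradiction refl x≢y

    -- Two distinct ends fix an edge up to order, and the reversed pair is excluded because both
    -- listed edges have their smaller end first.
    edge-determined : ∀ {e f x y} → e ∈ edges → f ∈ edges → x ≢ y →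
                      x ∈ₑ e → y ∈ₑ e → x ∈ₑ f → y ∈ₑ f → e ≡ f
    edge-determined e∈ f∈ x≢y (inj₁ refl) (inj₁ refl) _ _ = contradiction refl x≢y
    edge-determined e∈ f∈ x≢y (inj₂ refl) (inj₂ refl) _ _ = contradiction refl x≢y
    edge-determined e∈ f∈ x≢y _ _ (inj₁ refl) (inj₁ refl) = contradiction refl x≢y
    edge-determined e∈ f∈ x≢y _ _ (inj₂ refl) (inj₂ refl) = contradiction refl x≢y
    edge-determined e∈ f∈ x≢y (inj₁ refl) (inj₂ refl) (inj₁ refl) (inj₂ refl) = refl
    edge-determined e∈ f∈ x≢y (inj₂ refl) (inj₁ refl) (inj₂ refl) (inj₁ refl) = refl
    edge-determined e∈ f∈ x≢y (inj₁ refl) (inj₂ refl) (inj₂ refl) (inj₁ refl) =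
      contradiction (edge-ordered f∈) (Fin.<-asym (edge-ordered e∈))
    edge-determined e∈ f∈ x≢y (inj₂ refl) (inj₁ refl) (inj₁ refl) (inj₂ refl) =
      contradiction (edge-ordered f∈) (Fin.<-asym (edge-ordered e∈))

    -- Intersection, disjointness and incidence indicators

    shares-sym : ∀ {e f} → SharesVertex e f → SharesVertex f e
    shares-sym (w , w∈e , w∈f) = w , w∈f , w∈e

    S : Edge → Edge → ℤ
    S e f = ⟦ sharesVertex? e f ⟧

    D : Edge → Edge → ℤ
    D e f = ⟦ disjoint? e f ⟧

    I : Vertex → Edge → ℤ
    I w e = ⟦ w ∈ₑ? e ⟧

    S-sym : ∀ e f → S e f ≡ S f e
    S-sym e f = ⟦⟧-cong (sharesVertex? e f) (sharesVertex? f e) shares-sym shares-sym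

    D≡1-S : ∀ e f → D e f ≡ 1ℤ - S e f
    D≡1-S e f = ⟦⟧-¬ (sharesVertex? e f)

    D-sym : ∀ e f → D e f ≡ D f e
    D-sym e f = ⟦⟧-cong (disjoint? e f) (disjoint? f e) (λ d s → d (shares-sym s)) (λ d s → d (shares-sym s))

    D-irrefl : ∀ e → D e e ≡ 0ℤ
    D-irrefl e = ⟦⟧-false (disjoint? e e) λ d → d (proj₁ e , inj₁ refl , inj₁ refl)

    -- Pigeonhole principle on the two ends of `h`.
    three-of-two : ∀ h {x y z} → x ∈ₑ h → y ∈ₑ h → z ∈ₑ h → x ≡ y ⊎ x ≡ z ⊎ y ≡ z
    three-of-two h (inj₁ refl) (inj₁ refl) _           = inj₁ refl
    three-of-two h (inj₁ refl) (inj₂ refl) (inj₁ refl) = inj₂ (inj₁ refl)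
    three-of-two h (inj₁ refl) (inj₂ refl) (inj₂ refl) = inj₂ (inj₂ refl)
    three-of-two h (inj₂ refl) (inj₁ refl) (inj₁ refl) = inj₂ (inj₂ refl)
    three-of-two h (inj₂ refl) (inj₁ refl) (inj₂ refl) = inj₂ (inj₁ refl)
    three-of-two h (inj₂ refl) (inj₂ refl) _           = inj₁ refl

    meets-at-most-two : ∀ e f g h → Disjoint e f → Disjoint e g → Disjoint f g →
      SharesVertex e h → SharesVertex f h → ¬ SharesVertex g h
    meets-at-most-two e f g h e∥f e∥g f∥g (x , x∈e , x∈h) (y , y∈f , y∈h) (z , z∈g , z∈h)
      with three-of-two h x∈h y∈h z∈h
    ... | inj₁ refl        = e∥f (x , x∈e , y∈f)
    ... | inj₂ (inj₁ refl) = e∥g (x , x∈e , z∈g)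
    ... | inj₂ (inj₂ refl) = f∥g (y , y∈f , z∈g)

    DDD*SSS≡0 : ∀ e f g h → D e f * D e g * D f g * (S e h * S f h * S g h) ≡ 0ℤ
    DDD*SSS≡0 e f g h = ⟦⟧-exclusive
      (disjoint? e f) (disjoint? e g) (disjoint? f g) (sharesVertex? e h) (sharesVertex? f h) (sharesVertex? g h)
      (meets-at-most-two e f g h)

    S≡I+I-I*I : ∀ u v f → S (u , v) f ≡ I u f + I v f - I u f * I v f
    S≡I+I-I*I u v f = ⟦⟧-inclusion-exclusion (u ∈ₑ? f) (v ∈ₑ? f) (sharesVertex? (u , v) f)
      (λ u∈f → u , inj₁ refl , u∈f) (λ v∈f → v , inj₂ refl , v∈f)
      λ { (_ , inj₁ refl , u∈f) → inj₁ u∈f ; (_ , inj₂ refl , v∈f) → inj₂ v∈f }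

    ∑-edges : ∀ (φ : Edge → ℤ) →
      ∑ edges φ ≡ ∑[ u ← vertices ] ∑[ v ← vertices ] (⟦ (u Fin.<? v) ×-dec (u ~? v) ⟧ * φ (u , v))
    ∑-edges φ = trans (∑-filter _ (cartesianProduct vertices vertices) φ)
                      (∑-cartesianProduct vertices vertices _)

    -- An edge at `w` is listed with `w` either first or second, and for a neighbour `v` exactly one
    -- of the two orientations is listed.
    ∑-incident : ∀ w → ∑[ e ← edges ] I w e ≡ + degree w
    ∑-incident w = begin
      ∑[ e ← edges ] I w e
        ≡⟨ ∑-edges (I w) ⟩
      ∑[ u ← vertices ] ∑[ v ← vertices ] (X u v * I w (u , v))
        ≡⟨ ∑-cong vertices (λ u → trans (∑-cong vertices (split u)) (∑-+ vertices _ _)) ⟩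
      ∑[ u ← vertices ] (∑[ v ← vertices ] (δ u * X w v) + ∑[ v ← vertices ] (δ v * X u w))
        ≡⟨ ∑-+ vertices _ _ ⟩
      (∑[ u ← vertices ] ∑[ v ← vertices ] (δ u * X w v)) + (∑[ u ← vertices ] ∑[ v ← vertices ] (δ v * X u w))
        ≡⟨ cong₂ _+_
             (trans (∑-cong vertices λ u → ∑-*ˡ vertices (δ u) (X w)) (∑-allFin-δ w λ _ → ∑ vertices (X w)))
             (∑-cong vertices λ u → ∑-allFin-δ w λ _ → X u w) ⟩
      (∑[ v ← vertices ] X w v) + (∑[ v ← vertices ] X v w)
        ≡⟨ ∑-+ vertices _ _ ⟨
      ∑[ v ← vertices ] (X w v + X v w)
        ≡⟨ ∑-cong vertices merge ⟩
      ∑[ v ← vertices ] ⟦ w ~? v ⟧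
        ≡⟨ +-length-filter (w ~?_) vertices ⟨
      + degree w ∎
      where
      X : Vertex → Vertex → ℤ
      X u v = ⟦ (u Fin.<? v) ×-dec (u ~? v) ⟧
      δ : Vertex → ℤ
      δ u = ⟦ w Fin.≟ u ⟧
      X-diag : ∀ u → X u u ≡ 0ℤ
      X-diag u = ⟦⟧-false ((u Fin.<? u) ×-dec (u ~? u)) λ (u<u , _) → Fin.<-irrefl refl u<u
      split : ∀ u v → X u v * I w (u , v) ≡ δ u * X w v + δ v * X u w
      split u v = cases (w Fin.≟ u) (w Fin.≟ v)
        where
        cases : (wu : Dec (w ≡ u)) (wv : Dec (w ≡ v)) →
                X u v * ⟦ wu ⊎-dec wv ⟧ ≡ ⟦ wu ⟧ * X w v + ⟦ wv ⟧ * X u w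
        -- When `u` and `v` both equal `w`, the right side counts the pair twice and the left side
        -- once; both vanish because no pair `(w , w)` is listed.
        cases (yes refl) (yes refl) = trans (cong (_* 1ℤ) (X-diag w)) (sym (cong (λ x → 1ℤ * x + 1ℤ * x) (X-diag w)))
        cases (yes refl) (no _)     = left (X w v)
          where
          left : ∀ x → x * 1ℤ ≡ 1ℤ * x + 0ℤ
          left = solve-∀
        cases (no _)     (yes refl) = right (X u w)
          where
          right : ∀ x → x * 1ℤ ≡ 0ℤ + 1ℤ * x
          right = solve-∀
        cases (no _)     (no _)     = *-zeroʳ (X u v)
      merge : ∀ v → X w v + X v w ≡ ⟦ w ~? v ⟧
      merge v = cases (Fin.<-cmp w v) (w ~? v)
        where
        wv = (w Fin.<? v) ×-dec (w ~? v)
        vw = (v Fin.<? w) ×-dec (v ~? w)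
        cases : Tri (w Fin.< v) (w ≡ v) (v Fin.< w) → (d : Dec (w ~ v)) → ⟦ wv ⟧ + ⟦ vw ⟧ ≡ ⟦ d ⟧
        cases _                (no ¬w~v) = cong₂ _+_ (⟦⟧-false wv λ (_ , w~v) → ¬w~v w~v) (⟦⟧-false vw λ (_ , v~w) → ¬w~v (~-sym v~w))
        cases (tri< w<v _ v≮w) (yes w~v) = cong₂ _+_ (⟦⟧-true wv (w<v , w~v)) (⟦⟧-false vw λ (v<w , _) → v≮w v<w)
        cases (tri≈ _ w≡v _)   (yes w~v) = contradiction w≡v (~⇒≢ w~v)
        cases (tri> w≮v _ v<w) (yes w~v) = cong₂ _+_ (⟦⟧-false wv λ (w<v , _) → w≮v w<v) (⟦⟧-true vw (v<w , ~-sym w~v))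

    -- Both sides add `φ w` over all incidences of a vertex `w` with an edge, grouped by edges on
    -- the left and by vertices on the right.
    ∑-endpoints : ∀ (φ : Vertex → ℤ) → ∑[ e ← edges ] (φ (proj₁ e) + φ (proj₂ e)) ≡ ∑[ w ← vertices ] (+ degree w * φ w)
    ∑-endpoints φ = begin
      ∑[ e ← edges ] (φ (proj₁ e) + φ (proj₂ e))
        ≡⟨ ∑-cong-∈ edges (λ (u , v) e∈ → sym (endpoints u v (~⇒≢ (edge-adjacent e∈)))) ⟩
      ∑[ e ← edges ] ∑[ w ← vertices ] (I w e * φ w)
        ≡⟨ ∑-swap edges vertices _ ⟩
      ∑[ w ← vertices ] ∑[ e ← edges ] (I w e * φ w)
        ≡⟨ ∑-cong vertices (λ w → trans (∑-*ʳ edges (I w) (φ w)) (cong (_* φ w) (∑-incident w))) ⟩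
      ∑[ w ← vertices ] (+ degree w * φ w) ∎
      where
      split : ∀ u v → u ≢ v → ∀ w → I w (u , v) * φ w ≡ ⟦ u Fin.≟ w ⟧ * φ w + ⟦ v Fin.≟ w ⟧ * φ w
      split u v u≢v w = trans (cong (_* φ w) I≡δ+δ) (*-distribʳ-+ (φ w) ⟦ u Fin.≟ w ⟧ ⟦ v Fin.≟ w ⟧)
        where
        I≡δ+δ : I w (u , v) ≡ ⟦ u Fin.≟ w ⟧ + ⟦ v Fin.≟ w ⟧
        I≡δ+δ = trans (⟦⟧-inclusion-exclusion (u Fin.≟ w) (v Fin.≟ w) (w ∈ₑ? (u , v))
            (λ u≡w → inj₁ (sym u≡w)) (λ v≡w → inj₂ (sym v≡w)) λ { (inj₁ w≡u) → inj₁ (sym w≡u) ; (inj₂ w≡v) → inj₂ (sym w≡v) })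
          (trans (cong (λ z → ⟦ u Fin.≟ w ⟧ + ⟦ v Fin.≟ w ⟧ - z)
            (trans (sym (⟦⟧-× (u Fin.≟ w) (v Fin.≟ w))) (⟦⟧-false ((u Fin.≟ w) ×-dec (v Fin.≟ w)) λ { (refl , refl) → u≢v refl })))
          (+-identityʳ _))
      endpoints : ∀ u v → u ≢ v → ∑[ w ← vertices ] (I w (u , v) * φ w) ≡ φ u + φ v
      endpoints u v u≢v = trans (∑-cong vertices (split u v u≢v))
        (trans (∑-+ vertices _ _) (cong₂ _+_ (∑-allFin-δ u φ) (∑-allFin-δ v φ)))

    -- Row sums of the intersection matrix in terms of degrees

    s : Edge → ℤ
    s e = ∑[ f ← edges ] S e f

    -- Because `S` is 1 on the diagonal, the count includes `e` and `f` themselves whenever they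
    -- meet.
    c : Edge → Edge → ℤ
    c e f = ∑[ g ← edges ] (S e g * S f g)

    t : Edge → ℤ
    t e = ∑[ f ← edges ] (S e f * c e f)

    -- The graph is simple, so the only edge containing both ends is `(u , v)`. This single overlap
    -- is the source of the `- 1ℤ` in `s≡` and `t≡`.
    ∑-parallel : ∀ {u v} → (u , v) ∈ edges → ∑[ f ← edges ] (I u f * I v f) ≡ 1ℤ
    ∑-parallel {u} {v} e∈ = trans (∑-cong edges λ f → sym (⟦⟧-× (u ∈ₑ? f) (v ∈ₑ? f)))
      (∑-unique (λ f → (u ∈ₑ? f) ×-dec (v ∈ₑ? f)) edges-unique e∈ (inj₁ refl , inj₂ refl)
        λ f f∈ (u∈f , v∈f) → edge-determined e∈ f∈ (~⇒≢ (edge-adjacent e∈)) (inj₁ refl) (inj₂ refl) u∈f v∈f)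

    s≡ : ∀ {u v} → (u , v) ∈ edges → s (u , v) ≡ + degree u + + degree v - 1ℤ
    s≡ {u} {v} e∈ = begin
      ∑[ f ← edges ] S (u , v) f
        ≡⟨ ∑-cong edges (λ f → trans (S≡I+I-I*I u v f) (expand (I u f) (I v f))) ⟩
      ∑[ f ← edges ] (1ℤ * I u f + (1ℤ * I v f + (- 1ℤ * (I u f * I v f) + 0ℤ)))
        ≡⟨ ∑-linear edges ((1ℤ , I u) ∷ (1ℤ , I v) ∷ (- 1ℤ , λ f → I u f * I v f) ∷ []) ⟩
      1ℤ * ∑ edges (I u) + (1ℤ * ∑ edges (I v) + (- 1ℤ * (∑[ f ← edges ] (I u f * I v f)) + 0ℤ))
        ≡⟨ cong₂ (λ x y → 1ℤ * x + y) (∑-incident u)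
             (cong₂ (λ x y → 1ℤ * x + (- 1ℤ * y + 0ℤ)) (∑-incident v) (∑-parallel e∈)) ⟩
      1ℤ * + degree u + (1ℤ * + degree v + (- 1ℤ * 1ℤ + 0ℤ))
        ≡⟨ collect (+ degree u) (+ degree v) ⟩
      + degree u + + degree v - 1ℤ ∎
      where
      expand : ∀ a b → a + b - a * b ≡ 1ℤ * a + (1ℤ * b + (- 1ℤ * (a * b) + 0ℤ))
      expand = solve-∀
      collect : ∀ a b → 1ℤ * a + (1ℤ * b + (- 1ℤ * 1ℤ + 0ℤ)) ≡ a + b - 1ℤ
      collect = solve-∀

    c-sym : ∀ e f → c e f ≡ c f e
    c-sym e f = ∑-cong edges λ g → *-comm (S e g) (S f g)

    module _ (triangle-free : ¬ HasCycle 3) where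

      -- A common vertex `w` of `f` and `g` would form a triangle with `u` and `v`: it differs from
      -- `v` since `v` is not on `f`, and from `u` since `u` is not on `g`.
      helly : ∀ {u v} → (u , v) ∈ edges → ∀ {f g} → f ∈ edges → g ∈ edges →
              u ∈ₑ f → ¬ v ∈ₑ f → v ∈ₑ g → ¬ u ∈ₑ g → ¬ SharesVertex f g
      helly e∈ f∈ g∈ u∈f v∉f v∈g u∉g (w , w∈f , w∈g) = triangle-free (triangle⇒cycle
        (edge-adjacent e∈)
        (∈ₑ-adjacent g∈ v∈g w∈g λ { refl → v∉f w∈f })
        (∈ₑ-adjacent f∈ w∈f u∈f λ { refl → u∉g w∈g }))

      -- Inclusion-exclusion over the end of `(u , v)` at which the three edges meet: pairwise
      -- intersection already forces such a common end.
      SSS≡ : ∀ {u v} → (u , v) ∈ edges → ∀ f → f ∈ edges → ∀ g → g ∈ edges →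
        S (u , v) f * (S (u , v) g * S f g) ≡
        I u f * I u g + I v f * I v g - (I u f * I v f) * (I u g * I v g)
      SSS≡ {u} {v} e∈ f f∈ g g∈ = trans
        (cong₂ (λ x y → x * (y * S f g)) (S≡I+I-I*I u v f) (S≡I+I-I*I u v g))
        (cases (u ∈ₑ? f) (v ∈ₑ? f) (u ∈ₑ? g) (v ∈ₑ? g))
        where
        sh : ∀ {w} → w ∈ₑ f → w ∈ₑ g → 1ℤ * (1ℤ * S f g) ≡ 1ℤ
        sh {w} w∈f w∈g = cong (λ z → 1ℤ * (1ℤ * z)) (⟦⟧-true (sharesVertex? f g) (w , w∈f , w∈g))
        ¬sh : ¬ SharesVertex f g → 1ℤ * (1ℤ * S f g) ≡ 0ℤ
        ¬sh f∥g = cong (λ z → 1ℤ * (1ℤ * z)) (⟦⟧-false (sharesVertex? f g) f∥g)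
        cases : (uf : Dec (u ∈ₑ f)) (vf : Dec (v ∈ₑ f)) (ug : Dec (u ∈ₑ g)) (vg : Dec (v ∈ₑ g)) →
          (⟦ uf ⟧ + ⟦ vf ⟧ - ⟦ uf ⟧ * ⟦ vf ⟧) * ((⟦ ug ⟧ + ⟦ vg ⟧ - ⟦ ug ⟧ * ⟦ vg ⟧) * S f g) ≡
          ⟦ uf ⟧ * ⟦ ug ⟧ + ⟦ vf ⟧ * ⟦ vg ⟧ - (⟦ uf ⟧ * ⟦ vf ⟧) * (⟦ ug ⟧ * ⟦ vg ⟧)
        cases (no _)    (no _)    _         _         = refl
        cases (yes _)   (yes _)   (no _)    (no _)    = refl
        cases (yes _)   (no _)    (no _)    (no _)    = refl
        cases (no _)    (yes _)   (no _)    (no _)    = refl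
        cases (yes u∈f) (yes _)   (yes u∈g) (yes _)   = sh u∈f u∈g
        cases (yes u∈f) (yes _)   (yes u∈g) (no _)    = sh u∈f u∈g
        cases (yes u∈f) (no _)    (yes u∈g) (yes _)   = sh u∈f u∈g
        cases (yes u∈f) (no _)    (yes u∈g) (no _)    = sh u∈f u∈g
        cases (yes _)   (yes v∈f) (no _)    (yes v∈g) = sh v∈f v∈g
        cases (no _)    (yes v∈f) (yes _)   (yes v∈g) = sh v∈f v∈g
        cases (no _)    (yes v∈f) (no _)    (yes v∈g) = sh v∈f v∈g
        -- In this case and the next, `f` and `g` touch the edge at different ends only; these are
        -- the cases that use the absence of triangles.
        cases (yes u∈f) (no v∉f)  (no u∉g)  (yes v∈g) = ¬sh (helly e∈ f∈ g∈ u∈f v∉f v∈g u∉g)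
        cases (no u∉f)  (yes v∈f) (yes u∈g) (no v∉g)  =
          ¬sh λ f∦g → helly e∈ g∈ f∈ u∈g v∉g v∈f u∉f (shares-sym {f} {g} f∦g)

      -- The pairs `(f , g)` through `u` number the square of its degree, likewise for `v`; the pair
      -- consisting of the edge itself twice is counted at both ends.
      t≡ : ∀ {u v} → (u , v) ∈ edges → t (u , v) ≡ + degree u * + degree u + + degree v * + degree v - 1ℤ
      t≡ {u} {v} e∈ = begin
        ∑[ f ← edges ] (S e f * c e f)
          ≡⟨ ∑-cong-∈ edges inner ⟩
        ∑[ f ← edges ] (du * I u f + (dv * I v f + (- 1ℤ * (I u f * I v f) + 0ℤ)))
          ≡⟨ ∑-linear edges ((du , I u) ∷ (dv , I v) ∷ (- 1ℤ , λ f → I u f * I v f) ∷ []) ⟩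
        du * ∑ edges (I u) + (dv * ∑ edges (I v) + (- 1ℤ * (∑[ f ← edges ] (I u f * I v f)) + 0ℤ))
          ≡⟨ cong₂ (λ x y → du * x + y) (∑-incident u)
               (cong₂ (λ x y → dv * x + (- 1ℤ * y + 0ℤ)) (∑-incident v) (∑-parallel e∈)) ⟩
        du * du + (dv * dv + (- 1ℤ * 1ℤ + 0ℤ))
          ≡⟨ collect (du * du) (dv * dv) ⟩
        du * du + dv * dv - 1ℤ ∎
        where
        e = u , v
        du = + degree u
        dv = + degree v
        collect : ∀ a b → a + (b + (- 1ℤ * 1ℤ + 0ℤ)) ≡ a + b - 1ℤ
        collect = solve-∀
        inner : ∀ f → f ∈ edges → S e f * c e f ≡ du * I u f + (dv * I v f + (- 1ℤ * (I u f * I v f) + 0ℤ))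
        inner f f∈ = begin
          S e f * c e f
            ≡⟨ ∑-*ˡ edges (S e f) _ ⟨
          ∑[ g ← edges ] (S e f * (S e g * S f g))
            ≡⟨ ∑-cong-∈ edges (λ g g∈ → trans (SSS≡ e∈ f f∈ g g∈)
                 (expand (I u f) (I u g) (I v f) (I v g) (I u f * I v f) (I u g * I v g))) ⟩
          ∑[ g ← edges ] (I u f * I u g + (I v f * I v g + (- (I u f * I v f) * (I u g * I v g) + 0ℤ)))
            ≡⟨ ∑-linear edges ((I u f , I u) ∷ (I v f , I v) ∷ (- (I u f * I v f) , λ g → I u g * I v g) ∷ []) ⟩
          I u f * ∑ edges (I u) + (I v f * ∑ edges (I v) + (- (I u f * I v f) * (∑[ g ← edges ] (I u g * I v g)) + 0ℤ))
            ≡⟨ cong₂ (λ x y → I u f * x + y) (∑-incident u)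
               (cong₂ (λ x y → I v f * x + (- (I u f * I v f) * y + 0ℤ)) (∑-incident v) (∑-parallel e∈)) ⟩
          I u f * du + (I v f * dv + (- (I u f * I v f) * 1ℤ + 0ℤ))
            ≡⟨ collect′ (I u f) (I v f) (I u f * I v f) du dv ⟩
          du * I u f + (dv * I v f + (- 1ℤ * (I u f * I v f) + 0ℤ)) ∎
          where
          expand : ∀ a b c d j k → a * b + c * d - j * k ≡ a * b + (c * d + (- j * k + 0ℤ))
          expand = solve-∀
          collect′ : ∀ a b j x y → a * x + (b * y + (- j * 1ℤ + 0ℤ)) ≡ x * a + (y * b + (- 1ℤ * j + 0ℤ))
          collect′ = solve-∀

      module _ (square-free : ¬ HasCycle 4) where

        -- Let `g` join `a` on `e` to `b` on `f`, and `h` join `a′` to `b′`. If both ends agree the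
        -- edges are equal, if exactly one agrees there is a triangle, and if none agrees there is a
        -- 4-cycle `a b b′ a′`.
        connecting-edge-unique : ∀ {e f} → e ∈ edges → f ∈ edges → Disjoint e f →
          ∀ g h → g ∈ edges → h ∈ edges →
          SharesVertex e g × SharesVertex f g → SharesVertex e h × SharesVertex f h → g ≡ h
        connecting-edge-unique {e} {f} e∈ f∈ e∥f g h g∈ h∈
          ((a , a∈e , a∈g) , (b , b∈f , b∈g)) ((a′ , a′∈e , a′∈h) , (b′ , b′∈f , b′∈h)) =
          cases (a Fin.≟ a′) (b Fin.≟ b′)
          where
          apart : ∀ {x y} → x ∈ₑ e → y ∈ₑ f → x ≢ y
          apart x∈e y∈f refl = e∥f (_ , x∈e , y∈f)
          a~b : a ~ b
          a~b = ∈ₑ-adjacent g∈ a∈g b∈g (apart a∈e b∈f)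
          b′~a′ : b′ ~ a′
          b′~a′ = ~-sym (∈ₑ-adjacent h∈ a′∈h b′∈h (apart a′∈e b′∈f))
          cases : Dec (a ≡ a′) → Dec (b ≡ b′) → g ≡ h
          cases (yes refl) (yes refl) = edge-determined g∈ h∈ (apart a∈e b∈f) a∈g b∈g a′∈h b′∈h
          cases (yes refl) (no b≢b′)  =
            contradiction (triangle⇒cycle a~b (∈ₑ-adjacent f∈ b∈f b′∈f b≢b′) b′~a′) triangle-free
          cases (no a≢a′)  (yes refl) =
            contradiction (triangle⇒cycle a~b b′~a′ (∈ₑ-adjacent e∈ a′∈e a∈e (≢-sym a≢a′))) triangle-free
          cases (no a≢a′)  (no b≢b′)  =
            contradiction (square⇒cycle (apart a∈e b′∈f) (≢-sym (apart a′∈e b∈f))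
              a~b (∈ₑ-adjacent f∈ b∈f b′∈f b≢b′) b′~a′ (∈ₑ-adjacent e∈ a′∈e a∈e (≢-sym a≢a′))) square-free

        Dcc≡Dc : ∀ {e f} → e ∈ edges → f ∈ edges → D e f * (c e f * c e f) ≡ D e f * c e f
        Dcc≡Dc {e} {f} e∈ f∈ with sharesVertex? e f
        ... | yes _  = refl
        ... | no e∥f = cong (1ℤ *_) (begin
          c e f * c e f ≡⟨ cong₂ _*_ c≡ c≡ ⟩
          c′ * c′       ≡⟨ ∑-idempotent both? edges-unique (connecting-edge-unique e∈ f∈ e∥f) ⟩
          c′            ≡⟨ c≡ ⟨
          c e f         ∎)
          where
          both? = λ g → sharesVertex? e g ×-dec sharesVertex? f g
          c′ = ∑[ g ← edges ] ⟦ both? g ⟧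
          c≡ : c e f ≡ c′
          c≡ = ∑-cong edges λ g → sym (⟦⟧-× (sharesVertex? e g) (sharesVertex? f g))

    -- The sum over ordered quadruples of pairwise disjoint edges

    open Counting disjoint? using (ordered; !*count)
    open Triples edges

    N Σs : ℤ
    N = ∑[ e ← edges ] 1ℤ
    Σs = ∑ edges s

    q : Edge → ℤ
    q e = ∑[ f ← edges ] (S e f * s f)

    ∑-c : ∀ e → ∑[ f ← edges ] c e f ≡ q e
    ∑-c e = begin
      ∑[ f ← edges ] ∑[ g ← edges ] (S e g * S f g) ≡⟨ ∑-swap edges edges _ ⟩
      ∑[ g ← edges ] ∑[ f ← edges ] (S e g * S f g) ≡⟨ ∑-cong edges (λ g → trans (∑-*ˡ edges (S e g) λ f → S f g)
                                                         (cong (S e g *_) (∑-cong edges λ f → S-sym f g))) ⟩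
      q e ∎

    ∑-q : ∑ edges q ≡ ∑[ e ← edges ] (s e * s e)
    ∑-q = trans (∑-swap edges edges _) (∑-cong edges λ f → trans (∑-*ʳ edges (λ e → S e f) (s f))
      (cong (_* s f) (∑-cong edges λ e → S-sym e f)))

    ∑-D : ∀ e φ → ∑[ f ← edges ] (D e f * φ f) ≡ ∑ edges φ - ∑[ f ← edges ] (S e f * φ f)
    ∑-D e φ = begin
      ∑[ f ← edges ] (D e f * φ f)
        ≡⟨ ∑-cong edges (λ f → trans (cong (_* φ f) (D≡1-S e f)) (expand (S e f) (φ f))) ⟩
      ∑[ f ← edges ] (1ℤ * φ f + (- 1ℤ * (S e f * φ f) + 0ℤ))
        ≡⟨ ∑-linear edges ((1ℤ , φ) ∷ (- 1ℤ , λ f → S e f * φ f) ∷ []) ⟩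
      1ℤ * ∑ edges φ + (- 1ℤ * (∑[ f ← edges ] (S e f * φ f)) + 0ℤ)
        ≡⟨ collect (∑ edges φ) _ ⟩
      ∑ edges φ - ∑[ f ← edges ] (S e f * φ f) ∎
      where
      expand : ∀ a b → (1ℤ - a) * b ≡ 1ℤ * b + (- 1ℤ * (a * b) + 0ℤ)
      expand = solve-∀
      collect : ∀ a b → 1ℤ * a + (- 1ℤ * b + 0ℤ) ≡ a - b
      collect = solve-∀

    ∑-D1 : ∀ e → ∑[ f ← edges ] D e f ≡ N - s e
    ∑-D1 e = trans (∑-cong edges λ f → sym (*-identityʳ (D e f)))
      (trans (∑-D e λ _ → 1ℤ) (cong (_-_ N) (∑-cong edges λ f → *-identityʳ (S e f))))

    ∑-DD : ∀ e f → ∑[ g ← edges ] (D e g * D f g) ≡ N - s e - s f + c e f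
    ∑-DD e f = begin
      ∑[ g ← edges ] (D e g * D f g)
        ≡⟨ ∑-D e (D f) ⟩
      ∑ edges (D f) - ∑[ g ← edges ] (S e g * D f g)
        ≡⟨ cong₂ _-_ (∑-D1 f) (trans (∑-cong edges λ g → *-comm (S e g) (D f g)) (∑-D f (S e))) ⟩
      N - s f - (s e - ∑[ g ← edges ] (S f g * S e g))
        ≡⟨ collect N (s f) (s e) _ ⟩
      N - s e - s f + c f e
        ≡⟨ cong (_+_ (N - s e - s f)) (c-sym f e) ⟩
      N - s e - s f + c e f ∎
      where
      collect : ∀ n a b c → n - a - (b - c) ≡ n - b - a + c
      collect = solve-∀

    w : Edge → Edge → Edge → ℤ
    w e f g = D e f * D e g * D f g

    w-swap₁₂ : ∀ e f g → w e f g ≡ w f e g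
    w-swap₁₂ e f g = trans (cong (λ d → d * D e g * D f g) (D-sym e f)) (swap (D f e) (D e g) (D f g))
      where
      swap : ∀ a b c → a * b * c ≡ a * c * b
      swap = solve-∀

    w-swap₂₃ : ∀ e f g → w e f g ≡ w e g f
    w-swap₂₃ e f g = trans (cong (D e f * D e g *_) (D-sym f g)) (swap (D e f) (D e g) (D g f))
      where
      swap : ∀ a b c → a * b * c ≡ b * a * c
      swap = solve-∀

    -- The factor `w e f g` stays on both sides because it is what annihilates the last term
    -- `S e h * S f h * S g h` of the expanded product.
    ∑-wDDD : ∀ e f g → w e f g * ∑[ h ← edges ] (D e h * D f h * D g h) ≡
                        w e f g * (N - s e - s f - s g + c e f + c e g + c f g)
    ∑-wDDD e f g = begin
      w e f g * ∑[ h ← edges ] (D e h * D f h * D g h)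
        ≡⟨ ∑-*ˡ edges (w e f g) _ ⟨
      ∑[ h ← edges ] (w e f g * (D e h * D f h * D g h))
        ≡⟨ ∑-cong edges pointwise ⟩
      ∑[ h ← edges ] (w e f g * combine ts h)
        ≡⟨ ∑-*ˡ edges (w e f g) _ ⟩
      w e f g * ∑ edges (combine ts)
        ≡⟨ cong (w e f g *_) (trans (∑-linear edges ts) (collect N (s e) (s f) (s g) (c e f) (c e g) (c f g))) ⟩
      w e f g * (N - s e - s f - s g + c e f + c e g + c f g) ∎
      where
      ts : List (ℤ × (Edge → ℤ))
      ts = (1ℤ , λ _ → 1ℤ) ∷ (- 1ℤ , S e) ∷ (- 1ℤ , S f) ∷ (- 1ℤ , S g) ∷
           (1ℤ , λ h → S e h * S f h) ∷ (1ℤ , λ h → S e h * S g h) ∷ (1ℤ , λ h → S f h * S g h) ∷ []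
      expand : ∀ w x y z → w * ((1ℤ - x) * (1ℤ - y) * (1ℤ - z)) ≡
        w * (1ℤ * 1ℤ + (- 1ℤ * x + (- 1ℤ * y + (- 1ℤ * z + (1ℤ * (x * y) + (1ℤ * (x * z) + (1ℤ * (y * z) + 0ℤ)))))))
          - w * (x * y * z)
      expand = solve-∀
      collect : ∀ n a b c d e f → 1ℤ * n + (- 1ℤ * a + (- 1ℤ * b + (- 1ℤ * c + (1ℤ * d + (1ℤ * e + (1ℤ * f + 0ℤ)))))) ≡
        n - a - b - c + d + e + f
      collect = solve-∀
      pointwise : ∀ h → w e f g * (D e h * D f h * D g h) ≡ w e f g * combine ts h
      pointwise h = begin
        w e f g * (D e h * D f h * D g h)
          ≡⟨ cong₂ (λ a b → w e f g * (a * b)) (cong₂ _*_ (D≡1-S e h) (D≡1-S f h)) (D≡1-S g h) ⟩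
        w e f g * ((1ℤ - S e h) * (1ℤ - S f h) * (1ℤ - S g h))
          ≡⟨ expand (w e f g) (S e h) (S f h) (S g h) ⟩
        w e f g * combine ts h - w e f g * (S e h * S f h * S g h)
          ≡⟨ cong (_-_ (w e f g * combine ts h)) (DDD*SSS≡0 e f g h) ⟩
        w e f g * combine ts h - 0ℤ
          ≡⟨ +-identityʳ _ ⟩
        w e f g * combine ts h ∎

    ordered₄ : ordered 4 (λ _ → 1ℤ) edges ≡ ∑³ λ e f g → w e f g * (N - + 3 * s e + + 3 * c e f)
    ordered₄ = begin
      ordered 4 (λ _ → 1ℤ) edges
        ≡⟨ ∑-cong edges (λ e → trans (*-identityˡ (∑[ f ← edges ] _)) (∑-cong edges λ f → begin
             1ℤ * D e f * ∑[ g ← edges ] (1ℤ * D e g * D f g * ∑[ h ← edges ] (1ℤ * D e h * D f h * D g h * 1ℤ))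
               ≡⟨ ∑-*ˡ edges (1ℤ * D e f) _ ⟨
             ∑[ g ← edges ] (1ℤ * D e f * (1ℤ * D e g * D f g * ∑[ h ← edges ] (1ℤ * D e h * D f h * D g h * 1ℤ)))
               ≡⟨ ∑-cong edges (λ g → trans
                    (cong (λ z → 1ℤ * D e f * (1ℤ * D e g * D f g * z)) (∑-cong edges λ h → drop-1 (D e h) (D f h) (D g h)))
                    (assoc (D e f) (D e g) (D f g) (∑[ h ← edges ] (D e h * D f h * D g h)))) ⟩
             ∑[ g ← edges ] (w e f g * ∑[ h ← edges ] (D e h * D f h * D g h))
               ≡⟨ ∑-cong edges (∑-wDDD e f) ⟩
             ∑[ g ← edges ] (w e f g * (N - s e - s f - s g + c e f + c e g + c f g)) ∎)) ⟩
      ∑³ (λ e f g → w e f g * (N - s e - s f - s g + c e f + c e g + c f g))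
        ≡⟨ ∑³-symmetrize w w-swap₁₂ w-swap₂₃ N s c ⟩
      ∑³ (λ e f g → w e f g * (N - + 3 * s e + + 3 * c e f)) ∎
      where
      drop-1 : ∀ a b c → 1ℤ * a * b * c * 1ℤ ≡ a * b * c
      drop-1 = solve-∀
      assoc : ∀ a b c x → 1ℤ * a * (1ℤ * b * c * x) ≡ a * b * c * x
      assoc = solve-∀

    module _ (triangle-free : ¬ HasCycle 3) (square-free : ¬ HasCycle 4) where

      ∑-Dc : ∀ e → ∑[ f ← edges ] (D e f * c e f) ≡ q e - t e
      ∑-Dc e = trans (∑-D e (c e)) (cong (_- t e) (∑-c e))

      -- Exchanging the sums freezes the weight `s f`; by symmetry of `D` and `c` the inner sum is
      -- then that of `∑-Dc`.
      ∑∑-Dcs : ∑[ e ← edges ] ∑[ f ← edges ] (D e f * c e f * s f) ≡ ∑[ e ← edges ] ((q e - t e) * s e)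
      ∑∑-Dcs = trans (∑-swap edges edges _) (∑-cong edges λ f → trans (∑-*ʳ edges (λ e → D e f * c e f) (s f))
        (cong (_* s f) (trans (∑-cong edges λ e → cong₂ _*_ (D-sym e f) (c-sym e f)) (∑-Dc f))))

      ordered₄-by-edge : ordered 4 (λ _ → 1ℤ) edges ≡ ∑[ e ← edges ]
        ((N - + 3 * s e) * (N - s e) * (N - s e) - (N - + 3 * s e) * (Σs - q e)
          + (+ 4 * N + + 3 - + 9 * s e) * (q e - t e))
      ordered₄-by-edge = begin
        ordered 4 (λ _ → 1ℤ) edges
          ≡⟨ ordered₄ ⟩
        ∑³ (λ e f g → w e f g * (N - + 3 * s e + + 3 * c e f))
          ≡⟨ ∑-cong-∈ edges (λ e e∈ → ∑-cong-∈ edges λ f f∈ → sum-over-g e∈ f∈) ⟩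
        ∑[ e ← edges ] ∑[ f ← edges ] (combine (ts e) f)
          ≡⟨ ∑-cong edges (λ e → trans (∑-linear edges (ts e)) (cong₂ (λ x y → α e * x + y) (∑-D1 e)
               (cong₂ (λ x y → β e * x + y) (∑-D e s) (cong (λ x → γ e * x + (- + 3 * z e + 0ℤ)) (∑-Dc e))))) ⟩
        ∑[ e ← edges ] (α e * (N - s e) + (β e * (Σs - q e) + (γ e * (q e - t e) + (- + 3 * z e + 0ℤ))))
          ≡⟨ ∑-cong edges (λ e → regroup (α e * (N - s e)) (β e * (Σs - q e)) (γ e * (q e - t e)) (z e)) ⟩
        ∑[ e ← edges ] (1ℤ * y e + (- + 3 * z e + 0ℤ))
          ≡⟨ ∑-linear edges ((1ℤ , y) ∷ (- + 3 , z) ∷ []) ⟩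
        -- The part `z` is separated because its evaluation `z′` is available only for the total
        -- over `e`, not edge by edge. It turns the coefficient `- 6` of `s e` into `- 9`.
        1ℤ * ∑ edges y + (- + 3 * ∑ edges z + 0ℤ)
          ≡⟨ cong (λ x → 1ℤ * ∑ edges y + (- + 3 * x + 0ℤ)) ∑∑-Dcs ⟩
        1ℤ * ∑ edges y + (- + 3 * ∑ edges z′ + 0ℤ)
          ≡⟨ ∑-linear edges ((1ℤ , y) ∷ (- + 3 , z′) ∷ []) ⟨
        ∑[ e ← edges ] (1ℤ * y e + (- + 3 * z′ e + 0ℤ))
          ≡⟨ ∑-cong edges (λ e → simplify N Σs (s e) (q e) (t e)) ⟩
        _ ∎
        where
        α β γ y z z′ : Edge → ℤ
        α e = (N - + 3 * s e) * (N - s e)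
        β e = - (N - + 3 * s e)
        -- The bracket product contributes `4 N - 6 s e` to the coefficient of `D c`; the summand 3
        -- is what remains of `3 D c²` after `Dcc≡Dc`.
        γ e = + 4 * N + + 3 - + 6 * s e
        z e = ∑[ f ← edges ] (D e f * c e f * s f)
        z′ e = (q e - t e) * s e
        y e = α e * (N - s e) + (β e * (Σs - q e) + γ e * (q e - t e))
        ts : Edge → List (ℤ × (Edge → ℤ))
        ts e = (α e , D e) ∷ (β e , λ f → D e f * s f) ∷ (γ e , λ f → D e f * c e f) ∷ (- + 3 , λ f → D e f * c e f * s f) ∷ []
        regroup : ∀ a b c d → a + (b + (c + (- + 3 * d + 0ℤ))) ≡ 1ℤ * (a + (b + c)) + (- + 3 * d + 0ℤ)
        regroup = solve-∀
        simplify : ∀ n a s q t →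
          1ℤ * ((n - + 3 * s) * (n - s) * (n - s) + (- (n - + 3 * s) * (a - q) + (+ 4 * n + + 3 - + 6 * s) * (q - t)))
            + (- + 3 * ((q - t) * s) + 0ℤ) ≡
          (n - + 3 * s) * (n - s) * (n - s) - (n - + 3 * s) * (a - q) + (+ 4 * n + + 3 - + 9 * s) * (q - t)
        simplify = solve-∀
        factor : ∀ a b c x → a * b * c * x ≡ a * x * (b * c)
        factor = solve-∀
        expand : ∀ d n s s′ c → d * (n - + 3 * s + + 3 * c) * (n - s - s′ + c) ≡
          (n - + 3 * s) * (n - s) * d + (- (n - + 3 * s) * (d * s′)
            + ((+ 4 * n - + 6 * s) * (d * c) + (- + 3 * (d * c * s′) + 0ℤ))) + + 3 * (d * (c * c))
        expand = solve-∀
        sum-over-g : ∀ {e f} → e ∈ edges → f ∈ edges →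
          ∑[ g ← edges ] (w e f g * (N - + 3 * s e + + 3 * c e f)) ≡ combine (ts e) f
        sum-over-g {e} {f} e∈ f∈ = begin
          ∑[ g ← edges ] (w e f g * x)
            ≡⟨ ∑-cong edges (λ g → factor (D e f) (D e g) (D f g) x) ⟩
          ∑[ g ← edges ] (D e f * x * (D e g * D f g))
            ≡⟨ ∑-*ˡ edges (D e f * x) _ ⟩
          D e f * x * ∑[ g ← edges ] (D e g * D f g)
            ≡⟨ cong (D e f * x *_) (∑-DD e f) ⟩
          D e f * x * (N - s e - s f + c e f)
            ≡⟨ expand (D e f) N (s e) (s f) (c e f) ⟩
          rest + + 3 * (D e f * (c e f * c e f))
            ≡⟨ cong (λ u → rest + + 3 * u) (Dcc≡Dc triangle-free square-free e∈ f∈) ⟩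
          rest + + 3 * (D e f * c e f)
            ≡⟨ merge (α e * D e f) (β e * (D e f * s f)) N (s e) (D e f * c e f) (- + 3 * (D e f * c e f * s f)) ⟩
          combine (ts e) f ∎
          where
          x = N - + 3 * s e + + 3 * c e f
          rest = α e * D e f + (β e * (D e f * s f)
            + ((+ 4 * N - + 6 * s e) * (D e f * c e f) + (- + 3 * (D e f * c e f * s f) + 0ℤ)))
          merge : ∀ a b n s c d → a + (b + ((+ 4 * n - + 6 * s) * c + (d + 0ℤ))) + + 3 * c ≡
                                  a + (b + ((+ 4 * n + + 3 - + 6 * s) * c + (d + 0ℤ)))
          merge = solve-∀

    -- Degree invariants

    d₁ d₂ k : Edge → ℤ
    d₁ e = + degree (proj₁ e)
    d₂ e = + degree (proj₂ e)
    k  e = + edgeDegree e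

    -- Through `∑-endpoints` a power sum over edge ends gains one degree factor, so the first three
    -- are `M₁`, `F` and `M₁^ 4`.
    E₁ E₂ E₃ m₂ : ℤ
    E₁ = ∑[ e ← edges ] (d₁ e + d₂ e)
    E₂ = ∑[ e ← edges ] (d₁ e * d₁ e + d₂ e * d₂ e)
    E₃ = ∑[ e ← edges ] (d₁ e * d₁ e * d₁ e + d₂ e * d₂ e * d₂ e)
    m₂ = ∑[ e ← edges ] (d₁ e * d₂ e)

    +size : + size ≡ N
    +size = +-length edges

    +M₁^ : ∀ α → + M₁^ α G ≡ ∑[ v ← vertices ] + (degree v ^ α)
    +M₁^ α = +-sum-map vertices λ v → degree v ^ α

    +M₁ : + M₁ G ≡ E₁
    +M₁ = trans (+M₁^ 2) (trans (∑-cong vertices λ v → pos-^2 (degree v)) (sym (∑-endpoints λ v → + degree v)))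

    +F : + F G ≡ E₂
    +F = trans (+M₁^ 3) (trans (∑-cong vertices λ v → trans (pos-^suc (degree v) 2) (cong (+ degree v *_) (pos-^2 (degree v))))
      (sym (∑-endpoints λ v → + degree v * + degree v)))

    +M₁⁴ : + M₁^ 4 G ≡ E₃
    +M₁⁴ = trans (+M₁^ 4) (trans (∑-cong vertices λ v → trans (pos-^suc (degree v) 3) (cong (+ degree v *_)
        (trans (pos-^suc (degree v) 2) (trans (cong (+ degree v *_) (pos-^2 (degree v))) (sym (*-assoc (+ degree v) (+ degree v) (+ degree v)))))))
      (sym (∑-endpoints λ v → + degree v * + degree v * + degree v)))

    +M₂ : + M₂ G ≡ m₂
    +M₂ = trans (+-sum-map edges _) (∑-cong edges λ (u , v) → pos-* (degree u) (degree v))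

    degree-positive : ∀ {u v} → u ~ v → 1 ℕ.≤ degree u
    degree-positive {u} {v} u~v = ∈⇒1≤length (∈-filter⁺ (u ~?_) (∈-allFin v) u~v)

    -- Both ends of an edge have positive degree, so the truncated subtraction of 2 agrees with the
    -- one in ℤ. The difference 1 from `s e` is the edge itself.
    k≡ : ∀ {e} → e ∈ edges → k e ≡ s e - 1ℤ
    k≡ {u , v} e∈ = sym (begin
      s (u , v) - 1ℤ                            ≡⟨ cong (_- 1ℤ) (s≡ e∈) ⟩
      + degree u + + degree v - 1ℤ - 1ℤ         ≡⟨ +-assoc (+ degree u + + degree v) (- 1ℤ) (- 1ℤ) ⟩
      + (degree u ℕ.+ degree v) - + 2           ≡⟨ [+m]-[+n]≡m⊖n (degree u ℕ.+ degree v) 2 ⟩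
      (degree u ℕ.+ degree v) ⊖ 2               ≡⟨ ⊖-≥ (ℕ.+-mono-≤ (degree-positive u~v) (degree-positive (~-sym u~v))) ⟩
      + edgeDegree (u , v)                      ∎)
      where
      u~v = edge-adjacent e∈

    Σs≡ : Σs ≡ E₁ - N
    Σs≡ = trans (∑-cong-∈ edges λ e e∈ → trans (s≡ e∈) (expand (d₁ e) (d₂ e)))
      (trans (∑-linear edges ((1ℤ , λ e → d₁ e + d₂ e) ∷ (- 1ℤ , λ _ → 1ℤ) ∷ [])) (collect E₁ N))
      where
      expand : ∀ a b → a + b - 1ℤ ≡ 1ℤ * (a + b) + (- 1ℤ * 1ℤ + 0ℤ)
      expand = solve-∀
      collect : ∀ x n → 1ℤ * x + (- 1ℤ * n + 0ℤ) ≡ x - n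
      collect = solve-∀

    -- Quadratic sums of `s` and the index `EM₂`

    Σs² Σsq : ℤ
    Σs² = ∑[ e ← edges ] (s e * s e)
    Σsq = ∑[ e ← edges ] (s e * q e)

    Σs²≡ : Σs² ≡ E₂ + + 2 * m₂ - + 2 * E₁ + N
    Σs²≡ = trans (∑-cong-∈ edges λ e e∈ → trans (cong₂ _*_ (s≡ e∈) (s≡ e∈)) (expand (d₁ e) (d₂ e)))
      (trans (∑-linear edges ((1ℤ , λ e → d₁ e * d₁ e + d₂ e * d₂ e) ∷ (+ 2 , λ e → d₁ e * d₂ e) ∷
                              (- + 2 , λ e → d₁ e + d₂ e) ∷ (1ℤ , λ _ → 1ℤ) ∷ []))
             (collect E₂ m₂ E₁ N))
      where
      expand : ∀ a b → (a + b - 1ℤ) * (a + b - 1ℤ) ≡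
        1ℤ * (a * a + b * b) + (+ 2 * (a * b) + (- + 2 * (a + b) + (1ℤ * 1ℤ + 0ℤ)))
      expand = solve-∀
      collect : ∀ x y z n → 1ℤ * x + (+ 2 * y + (- + 2 * z + (1ℤ * n + 0ℤ))) ≡ x + + 2 * y - + 2 * z + n
      collect = solve-∀

    -- This is the quadratic form of `S` at the vector `k = s - 1`. Since `S` is symmetric and maps
    -- the all-ones vector to `s`, the mixed terms equal `Σs²` and the constant term equals `Σs`.
    ∑∑Skk : ∑[ e ← edges ] ∑[ f ← edges ] (S e f * (k e * k f)) ≡ Σsq - + 2 * Σs² + Σs
    ∑∑Skk = begin
      ∑[ e ← edges ] ∑[ f ← edges ] (S e f * (k e * k f))
        ≡⟨ ∑-cong-∈ edges (λ e e∈ → trans (∑-cong-∈ edges λ f f∈ →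
             trans (cong₂ (λ x y → S e f * (x * y)) (k≡ e∈) (k≡ f∈)) (expand (S e f) (s e) (s f)))
             (∑-linear edges ((s e - 1ℤ , λ f → S e f * s f) ∷ (1ℤ - s e , S e) ∷ []))) ⟩
      ∑[ e ← edges ] ((s e - 1ℤ) * q e + ((1ℤ - s e) * s e + 0ℤ))
        ≡⟨ ∑-cong edges (λ e → expand′ (s e) (q e)) ⟩
      ∑[ e ← edges ] (1ℤ * (s e * q e) + (- 1ℤ * q e + (- 1ℤ * (s e * s e) + (1ℤ * s e + 0ℤ))))
        ≡⟨ ∑-linear edges ((1ℤ , λ e → s e * q e) ∷ (- 1ℤ , q) ∷ (- 1ℤ , λ e → s e * s e) ∷ (1ℤ , s) ∷ []) ⟩
      1ℤ * Σsq + (- 1ℤ * ∑ edges q + (- 1ℤ * Σs² + (1ℤ * Σs + 0ℤ)))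
        ≡⟨ cong (λ x → 1ℤ * Σsq + (- 1ℤ * x + (- 1ℤ * Σs² + (1ℤ * Σs + 0ℤ)))) ∑-q ⟩
      1ℤ * Σsq + (- 1ℤ * Σs² + (- 1ℤ * Σs² + (1ℤ * Σs + 0ℤ)))
        ≡⟨ collect Σsq Σs² Σs ⟩
      Σsq - + 2 * Σs² + Σs ∎
      where
      expand : ∀ x s r → x * ((s - 1ℤ) * (r - 1ℤ)) ≡ (s - 1ℤ) * (x * r) + ((1ℤ - s) * x + 0ℤ)
      expand = solve-∀
      expand′ : ∀ s q → (s - 1ℤ) * q + ((1ℤ - s) * s + 0ℤ) ≡ 1ℤ * (s * q) + (- 1ℤ * q + (- 1ℤ * (s * s) + (1ℤ * s + 0ℤ)))
      expand′ = solve-∀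
      collect : ∀ p b a → 1ℤ * p + (- 1ℤ * b + (- 1ℤ * b + (1ℤ * a + 0ℤ))) ≡ p - + 2 * b + a
      collect = solve-∀

    ∑Skk : ∑[ e ← edges ] (S e e * (k e * k e)) ≡ Σs² - + 2 * Σs + N
    ∑Skk = trans (∑-cong-∈ edges λ e e∈ → trans
        (cong₂ (λ x y → x * (y * y)) (⟦⟧-true (sharesVertex? e e) (proj₁ e , inj₁ refl , inj₁ refl)) (k≡ e∈)) (expand (s e)))
      (trans (∑-linear edges ((1ℤ , λ e → s e * s e) ∷ (- + 2 , s) ∷ (1ℤ , λ _ → 1ℤ) ∷ [])) (collect Σs² Σs N))
      where
      expand : ∀ s → 1ℤ * ((s - 1ℤ) * (s - 1ℤ)) ≡ 1ℤ * (s * s) + (- + 2 * s + (1ℤ * 1ℤ + 0ℤ))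
      expand = solve-∀
      collect : ∀ b a n → 1ℤ * b + (- + 2 * a + (1ℤ * n + 0ℤ)) ≡ b - + 2 * a + n
      collect = solve-∀

    +EM₂ : + EM₂ G ≡ ∑ (combinations 2 edges) (onPair λ e f → S e f * (k e * k f))
    +EM₂ = begin
      + EM₂ G
        ≡⟨ +-sum-map (adjacentEdges G) _ ⟩
      ∑ (adjacentEdges G) (λ (e , f) → + (edgeDegree e ℕ.* edgeDegree f))
        ≡⟨ trans (∑-filter _ (map _ (combinations 2 edges)) _) (∑-map (combinations 2 edges) _ _) ⟩
      _
        ≡⟨ ∑-cong (combinations 2 edges) (λ { (e ∷ f ∷ []) → cong (S e f *_) (pos-* (edgeDegree e) (edgeDegree f)) }) ⟩
      ∑ (combinations 2 edges) (onPair λ e f → S e f * (k e * k f)) ∎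

    -- Two evaluations of the quadratic form of `S` at `k` are compared: by linearity in `s`, and as
    -- its diagonal plus twice `EM₂`.
    Σsq≡ : Σsq ≡ + 2 * + EM₂ G + + 3 * Σs² - + 3 * Σs + N
    Σsq≡ = begin
      Σsq
        ≡⟨ isolate Σsq Σs² Σs ⟩
      (Σsq - + 2 * Σs² + Σs) + + 2 * Σs² - Σs
        ≡⟨ cong (λ x → x + + 2 * Σs² - Σs) (begin
             Σsq - + 2 * Σs² + Σs
               ≡⟨ ∑∑Skk ⟨
             ∑[ e ← edges ] ∑[ f ← edges ] (S e f * (k e * k f))
               ≡⟨ ∑-pairs _ (λ e f → cong₂ _*_ (S-sym e f) (*-comm (k e) (k f))) edges ⟩
             (∑[ e ← edges ] (S e e * (k e * k e))) + + 2 * ∑ (combinations 2 edges) (onPair λ e f → S e f * (k e * k f))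
               ≡⟨ cong₂ (λ x y → x + + 2 * y) ∑Skk (sym +EM₂) ⟩
             Σs² - + 2 * Σs + N + + 2 * + EM₂ G ∎) ⟩
      Σs² - + 2 * Σs + N + + 2 * + EM₂ G + + 2 * Σs² - Σs
        ≡⟨ collect Σs² Σs N (+ EM₂ G) ⟩
      + 2 * + EM₂ G + + 3 * Σs² - + 3 * Σs + N ∎
      where
      isolate : ∀ p b a → p ≡ (p - + 2 * b + a) + + 2 * b - a
      isolate = solve-∀
      collect : ∀ b a n e → b - + 2 * a + n + + 2 * e + + 2 * b - a ≡ + 2 * e + + 3 * b - + 3 * a + n
      collect = solve-∀

    -- The coefficients are those of the theorem multiplied by 24. Powers are taken in ℕ before the
    -- cast, as in the statement, and single invariants are padded with a factor 1.
    terms : List (ℤ × ℤ × ℤ)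
    terms = (+ 1 , + (size ^ 4) , + 1) ∷ (+ 6 , + (size ^ 3) , + 1) ∷ (+ 19 , + (size ^ 2) , + 1) ∷
            (- + 66 , + size , + 1) ∷ (+ 3 , + (M₁ G ^ 2) , + 1) ∷ (+ 8 , + size , + F G) ∷
            (- + 6 , + (size ^ 2) , + M₁ G) ∷ (+ 24 , + size , + M₂ G) ∷ (+ 6 , + M₁^ 4 G , + 1) ∷
            (- + 48 , + M₂ G , + 1) ∷ (- + 30 , + size , + M₁ G) ∷ (+ 84 , + M₁ G , + 1) ∷
            (- + 24 , + EM₂ G , + 1) ∷ (- + 36 , + F G , + 1) ∷ []

    -- Assembling the formula for 24 p(G;4)

    module _ (triangle-free : ¬ HasCycle 3) (square-free : ¬ HasCycle 4) where

      Σt≡ : ∑ edges t ≡ E₂ - N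
      Σt≡ = trans (∑-cong-∈ edges λ e e∈ → trans (t≡ triangle-free e∈) (expand (d₁ e * d₁ e) (d₂ e * d₂ e)))
        (trans (∑-linear edges ((1ℤ , λ e → d₁ e * d₁ e + d₂ e * d₂ e) ∷ (- 1ℤ , λ _ → 1ℤ) ∷ [])) (collect E₂ N))
        where
        expand : ∀ a b → a + b - 1ℤ ≡ 1ℤ * (a + b) + (- 1ℤ * 1ℤ + 0ℤ)
        expand = solve-∀
        collect : ∀ x n → 1ℤ * x + (- 1ℤ * n + 0ℤ) ≡ x - n
        collect = solve-∀

      -- Separately, the sums of s t and s³ involve Σ d(u) d(v) (d(u) + d(v)), which
      -- cancels in this combination.
      cubic : ℤ
      cubic = ∑[ e ← edges ] (+ 9 * (s e * t e) - + 3 * (s e * s e * s e))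

      cubic≡ : cubic ≡ + 6 * E₃ + + 18 * m₂ - + 18 * E₁ + + 12 * N
      cubic≡ = trans (∑-cong-∈ edges λ e e∈ → trans
          (cong₂ (λ x y → + 9 * (x * y) - + 3 * (x * x * x)) (s≡ e∈) (t≡ triangle-free e∈)) (expand (d₁ e) (d₂ e)))
        (trans (∑-linear edges ((+ 6 , λ e → d₁ e * d₁ e * d₁ e + d₂ e * d₂ e * d₂ e) ∷ (+ 18 , λ e → d₁ e * d₂ e) ∷
                                (- + 18 , λ e → d₁ e + d₂ e) ∷ (+ 12 , λ _ → 1ℤ) ∷ []))
               (collect E₃ m₂ E₁ N))
        where
        expand : ∀ a b →
          + 9 * ((a + b - 1ℤ) * (a * a + b * b - 1ℤ)) - + 3 * ((a + b - 1ℤ) * (a + b - 1ℤ) * (a + b - 1ℤ)) ≡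
          + 6 * (a * a * a + b * b * b) + (+ 18 * (a * b) + (- + 18 * (a + b) + (+ 12 * 1ℤ + 0ℤ)))
        expand = solve-∀
        collect : ∀ x y z n → + 6 * x + (+ 18 * y + (- + 18 * z + (+ 12 * n + 0ℤ))) ≡ + 6 * x + + 18 * y - + 18 * z + + 12 * n
        collect = solve-∀

      24p≡ : + 24 * + p G 4 ≡
        N * N * N * N + + 6 * (N * N * N) + + 19 * (N * N) - + 66 * N + + 3 * (E₁ * E₁) + + 8 * (N * E₂) - + 6 * (N * N * E₁)
          + + 24 * (N * m₂) + + 6 * E₃ - + 48 * m₂ - + 30 * (N * E₁) + + 84 * E₁ - + 24 * + EM₂ G - + 36 * E₂
      24p≡ = begin
        + 24 * + p G 4
          ≡⟨ !*count D-sym D-irrefl 4 edges ⟩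
        ordered 4 (λ _ → 1ℤ) edges
          ≡⟨ ordered₄-by-edge triangle-free square-free ⟩
        _
          ≡⟨ ∑-cong edges (λ e → expand N Σs (s e) (q e) (t e)) ⟩
        ∑ edges (combine ts)
          ≡⟨ ∑-linear edges ts ⟩
        (N * N * N - N * Σs) * N + ((+ 3 * Σs - + 5 * (N * N)) * Σs + (+ 7 * N * Σs² + ((+ 5 * N + + 3) * ∑ edges q
          + (- + 12 * Σsq + (- (+ 4 * N + + 3) * ∑ edges t + (1ℤ * cubic + 0ℤ))))))
          ≡⟨ cong₂ (λ x y → (N * N * N - N * Σs) * N + ((+ 3 * Σs - + 5 * (N * N)) * Σs + (+ 7 * N * Σs² + ((+ 5 * N + + 3) * x
               + (- + 12 * y + (- (+ 4 * N + + 3) * ∑ edges t + (1ℤ * cubic + 0ℤ))))))) ∑-q Σsq≡ ⟩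
        (N * N * N - N * Σs) * N + ((+ 3 * Σs - + 5 * (N * N)) * Σs + (+ 7 * N * Σs² + ((+ 5 * N + + 3) * Σs²
          + (- + 12 * (+ 2 * + EM₂ G + + 3 * Σs² - + 3 * Σs + N) + (- (+ 4 * N + + 3) * ∑ edges t + (1ℤ * cubic + 0ℤ))))))
          ≡⟨ cong₂ (λ b y → (N * N * N - N * Σs) * N + ((+ 3 * Σs - + 5 * (N * N)) * Σs + (+ 7 * N * b + ((+ 5 * N + + 3) * b
               + (- + 12 * (+ 2 * + EM₂ G + + 3 * b - + 3 * Σs + N) + y))))) Σs²≡
               (cong₂ (λ x y → - (+ 4 * N + + 3) * x + (1ℤ * y + 0ℤ)) Σt≡ cubic≡) ⟩
        -- `Σs` occurs both as a summed quantity and inside the coefficients of `ts`, so it is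
        -- replaced in all places at once.
        substituted Σs
          ≡⟨ cong substituted Σs≡ ⟩
        substituted (E₁ - N)
          ≡⟨ collect N E₁ E₂ E₃ m₂ (+ EM₂ G) ⟩
        _ ∎
        where
        ts : List (ℤ × (Edge → ℤ))
        ts = (N * N * N - N * Σs , λ _ → 1ℤ) ∷ (+ 3 * Σs - + 5 * (N * N) , s) ∷ (+ 7 * N , λ e → s e * s e) ∷
             (+ 5 * N + + 3 , q) ∷ (- + 12 , λ e → s e * q e) ∷ (- (+ 4 * N + + 3) , t) ∷
             (1ℤ , λ e → + 9 * (s e * t e) - + 3 * (s e * s e * s e)) ∷ []
        substituted : ℤ → ℤ
        substituted a = (N * N * N - N * a) * N + ((+ 3 * a - + 5 * (N * N)) * a + (+ 7 * N * (E₂ + + 2 * m₂ - + 2 * E₁ + N)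
          + ((+ 5 * N + + 3) * (E₂ + + 2 * m₂ - + 2 * E₁ + N)
          + (- + 12 * (+ 2 * + EM₂ G + + 3 * (E₂ + + 2 * m₂ - + 2 * E₁ + N) - + 3 * a + N)
          + (- (+ 4 * N + + 3) * (E₂ - N) + (1ℤ * (+ 6 * E₃ + + 18 * m₂ - + 18 * E₁ + + 12 * N) + 0ℤ))))))
        expand : ∀ n a s q t →
          (n - + 3 * s) * (n - s) * (n - s) - (n - + 3 * s) * (a - q) + (+ 4 * n + + 3 - + 9 * s) * (q - t) ≡
          (n * n * n - n * a) * 1ℤ + ((+ 3 * a - + 5 * (n * n)) * s + (+ 7 * n * (s * s) + ((+ 5 * n + + 3) * q
            + (- + 12 * (s * q) + (- (+ 4 * n + + 3) * t + (1ℤ * (+ 9 * (s * t) - + 3 * (s * s * s)) + 0ℤ))))))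
        expand = solve-∀
        collect : ∀ n e₁ e₂ e₃ m₂ em →
          (n * n * n - n * (e₁ - n)) * n + ((+ 3 * (e₁ - n) - + 5 * (n * n)) * (e₁ - n) + (+ 7 * n * (e₂ + + 2 * m₂ - + 2 * e₁ + n)
          + ((+ 5 * n + + 3) * (e₂ + + 2 * m₂ - + 2 * e₁ + n)
          + (- + 12 * (+ 2 * em + + 3 * (e₂ + + 2 * m₂ - + 2 * e₁ + n) - + 3 * (e₁ - n) + n)
          + (- (+ 4 * n + + 3) * (e₂ - n) + (1ℤ * (+ 6 * e₃ + + 18 * m₂ - + 18 * e₁ + + 12 * n) + 0ℤ)))))) ≡
          n * n * n * n + + 6 * (n * n * n) + + 19 * (n * n) - + 66 * n + + 3 * (e₁ * e₁) + + 8 * (n * e₂) - + 6 * (n * n * e₁)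
          + + 24 * (n * m₂) + + 6 * e₃ - + 48 * m₂ - + 30 * (n * e₁) + + 84 * e₁ - + 24 * em - + 36 * e₂
        collect = solve-∀

      24p≡quadratic : + 24 * + p G 4 ≡ quadratic terms
      24p≡quadratic = begin
        + 24 * + p G 4
          ≡⟨ 24p≡ ⟩
        value N E₁ E₂ E₃ m₂
          ≡⟨ cong₂ (λ e₃ y → value N E₁ E₂ e₃ y) (sym +M₁⁴) (sym +M₂) ⟩
        value N E₁ E₂ (+ M₁^ 4 G) (+ M₂ G)
          ≡⟨ cong₂ (λ x y → value N x y (+ M₁^ 4 G) (+ M₂ G)) (sym +M₁) (sym +F) ⟩
        value N (+ M₁ G) (+ F G) (+ M₁^ 4 G) (+ M₂ G)
          ≡⟨ cong (λ x → value x (+ M₁ G) (+ F G) (+ M₁^ 4 G) (+ M₂ G)) (sym +size) ⟩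
        value (+ size) (+ M₁ G) (+ F G) (+ M₁^ 4 G) (+ M₂ G)
          ≡⟨ arrange (+ size) (+ M₁ G) (+ F G) (+ M₁^ 4 G) (+ M₂ G) (+ EM₂ G) ⟩
        quad (sz * (sz * (sz * sz))) (sz * (sz * sz)) (sz * sz) (+ M₁ G * + M₁ G)
          ≡⟨ cong₂ (λ x y → quad x y (sz * sz) (+ M₁ G * + M₁ G))
               (sym (trans (pos-^suc size 3) (cong (sz *_) (trans (pos-^suc size 2) (cong (sz *_) (pos-^2 size))))))
               (sym (trans (pos-^suc size 2) (cong (sz *_) (pos-^2 size)))) ⟩
        quad (+ (size ^ 4)) (+ (size ^ 3)) (sz * sz) (+ M₁ G * + M₁ G)
          ≡⟨ cong₂ (quad (+ (size ^ 4)) (+ (size ^ 3))) (sym (pos-^2 size)) (sym (pos-^2 (M₁ G))) ⟩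
        quadratic terms ∎
        where
        sz = + size
        value : ℤ → ℤ → ℤ → ℤ → ℤ → ℤ
        value n e₁ e₂ e₃ m₂ =
          n * n * n * n + + 6 * (n * n * n) + + 19 * (n * n) - + 66 * n + + 3 * (e₁ * e₁) + + 8 * (n * e₂) - + 6 * (n * n * e₁)
          + + 24 * (n * m₂) + + 6 * e₃ - + 48 * m₂ - + 30 * (n * e₁) + + 84 * e₁ - + 24 * + EM₂ G - + 36 * e₂
        quad : ℤ → ℤ → ℤ → ℤ → ℤ
        quad n⁴ n³ n² e₁² = quadratic ((+ 1 , n⁴ , + 1) ∷ (+ 6 , n³ , + 1) ∷ (+ 19 , n² , + 1) ∷
              (- + 66 , + size , + 1) ∷ (+ 3 , e₁² , + 1) ∷ (+ 8 , + size , + F G) ∷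
              (- + 6 , n² , + M₁ G) ∷ (+ 24 , + size , + M₂ G) ∷ (+ 6 , + M₁^ 4 G , + 1) ∷
              (- + 48 , + M₂ G , + 1) ∷ (- + 30 , + size , + M₁ G) ∷ (+ 84 , + M₁ G , + 1) ∷
              (- + 24 , + EM₂ G , + 1) ∷ (- + 36 , + F G , + 1) ∷ [])
        arrange : ∀ n e₁ e₂ e₃ m₂ em →
          n * n * n * n + + 6 * (n * n * n) + + 19 * (n * n) - + 66 * n + + 3 * (e₁ * e₁) + + 8 * (n * e₂) - + 6 * (n * n * e₁)
          + + 24 * (n * m₂) + + 6 * e₃ - + 48 * m₂ - + 30 * (n * e₁) + + 84 * e₁ - + 24 * em - + 36 * e₂ ≡
          + 1 * (n * (n * (n * n)) * + 1) + (+ 6 * (n * (n * n) * + 1) + (+ 19 * (n * n * + 1) + (- + 66 * (n * + 1) +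
          (+ 3 * (e₁ * e₁ * + 1) + (+ 8 * (n * e₂) + (- + 6 * (n * n * e₁) + (+ 24 * (n * m₂) + (+ 6 * (e₃ * + 1) +
          (- + 48 * (m₂ * + 1) + (- + 30 * (n * e₁) + (+ 84 * (e₁ * + 1) + (- + 24 * (em * + 1) + (- + 36 * (e₂ * + 1) + + 0)))))))))))))
        arrange = solve-∀

open IntegerIdentity

-- Transfer to ℚ

open import Data.Integer as ℤ using (ℤ; +_)
import Data.Integer.Properties as ℤₚ
open import Data.List using (List; []; _∷_)
open import Data.Nat as ℕ using (ℕ; _^_)
import Data.Nat.Properties as ℕ
open import Data.Product using (_×_; _,_)
open import Data.Rational using (ℚ; 0ℚ; _+_; _-_; _*_; _/_)
open import Data.Rational.Literals using (fromℤ)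
open import Data.Rational.Properties using (toℚᵘ-injective; toℚᵘ-homo-+; toℚᵘ-homo-*)
open import Data.Rational.Solver using (module +-*-Solver)
import Data.Rational.Unnormalised as ℚᵘ
import Data.Rational.Unnormalised.Properties as ℚᵘ
open import Relation.Binary.PropositionalEquality
open import Relation.Nullary using (¬_)
open ≡-Reasoning

-- Addition in ℚ normalises by a gcd and does not compute on variables. Among unnormalised rationals
-- the claim is an equation of cross products with all denominators 1.
fromℤ-homo-+ : ∀ i j → fromℤ (i ℤ.+ j) ≡ fromℤ i + fromℤ j
fromℤ-homo-+ i j = toℚᵘ-injective (ℚᵘ.≃-trans
  (ℚᵘ.*≡* (cong (ℤ._* + 1) (sym (cong₂ ℤ._+_ (ℤₚ.*-identityʳ i) (ℤₚ.*-identityʳ j)))))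
  (ℚᵘ.≃-sym (toℚᵘ-homo-+ (fromℤ i) (fromℤ j))))

fromℤ-homo-* : ∀ i j → fromℤ (i ℤ.* j) ≡ fromℤ i * fromℤ j
fromℤ-homo-* i j = toℚᵘ-injective (ℚᵘ.≃-trans (ℚᵘ.*≡* refl) (ℚᵘ.≃-sym (toℚᵘ-homo-* (fromℤ i) (fromℤ j))))

quadraticℚ : List (ℤ × ℤ × ℤ) → ℚ
quadraticℚ []                 = 0ℚ
quadraticℚ ((k , i , j) ∷ ts) = fromℤ k * (fromℤ i * fromℤ j) + quadraticℚ ts

fromℤ-quadratic : ∀ ts → fromℤ (quadratic ts) ≡ quadraticℚ ts
fromℤ-quadratic []                 = refl
fromℤ-quadratic ((k , i , j) ∷ ts) = begin
  fromℤ (k ℤ.* (i ℤ.* j) ℤ.+ quadratic ts)          ≡⟨ fromℤ-homo-+ (k ℤ.* (i ℤ.* j)) (quadratic ts) ⟩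
  fromℤ (k ℤ.* (i ℤ.* j)) + fromℤ (quadratic ts)    ≡⟨ cong₂ _+_ (trans (fromℤ-homo-* k (i ℤ.* j)) (cong (fromℤ k *_) (fromℤ-homo-* i j)))
                                                                   (fromℤ-quadratic ts) ⟩
  fromℤ k * (fromℤ i * fromℤ j) + quadraticℚ ts ∎

theorem2p9 : ∀ (G : Graph) → [ 5 ] ≤⁺ girth G →
    let m   = fromℕ (Graph.size G)
        m²  = fromℕ (Graph.size G ^ 2)
        m³  = fromℕ (Graph.size G ^ 3)
        m⁴  = fromℕ (Graph.size G ^ 4)
        M1  = fromℕ (M₁ G)
        M1² = fromℕ (M₁ G ^ 2)
        M14 = fromℕ (M₁^ 4 G)
        M2  = fromℕ (M₂ G)
        EM2 = fromℕ (EM₂ G)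
        F3  = fromℕ (F G)
    in fromℕ (p G 4) ≡
         (+ 1 / 24) * m⁴ + (+ 1 / 4) * m³ + (+ 19 / 24) * m² - (+ 11 / 4) * m
         + (+ 1 / 8) * M1² + (+ 1 / 3) * (m * F3) - (+ 1 / 4) * (m² * M1)
         + m * M2 + (+ 1 / 4) * M14 - fromℕ 2 * M2 - (+ 5 / 4) * (m * M1)
         + (+ 7 / 2) * M1 - EM2 - (+ 3 / 2) * F3
theorem2p9 G 5≤g = begin
  fromℕ (p G 4)
    ≡⟨ solve 1 (λ x → x := con (+ 1 / 24) :* (con (fromℕ 24) :* x)) refl (fromℕ (p G 4)) ⟩
  (+ 1 / 24) * (fromℕ 24 * fromℕ (p G 4))
    ≡⟨ cong ((+ 1 / 24) *_) (fromℤ-homo-* (+ 24) (+ p G 4)) ⟨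
  (+ 1 / 24) * fromℤ (+ 24 ℤ.* + p G 4)
    ≡⟨ cong (λ x → (+ 1 / 24) * fromℤ x) (24p≡quadratic G (no-short-cycle 3 (ℕ.≤ᵇ⇒≤ 4 5 _)) (no-short-cycle 4 ℕ.≤-refl)) ⟩
  (+ 1 / 24) * fromℤ (quadratic (terms G))
    ≡⟨ cong ((+ 1 / 24) *_) (fromℤ-quadratic (terms G)) ⟩
  (+ 1 / 24) * quadraticℚ (terms G)
    -- The powers of `m` and the square of `M1` are variables of their own here, so that each
    -- monomial is matched with its counterpart after division by 24.
    ≡⟨ solve 10 (λ m m² m³ m⁴ M1 M1² M14 M2 EM2 F3 →
         con (+ 1 / 24) :* (con (fromℤ (+ 1)) :* (m⁴ :* 𝟙) :+ (con (fromℤ (+ 6)) :* (m³ :* 𝟙) :+ (con (fromℤ (+ 19)) :* (m² :* 𝟙) :+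
           (con (fromℤ (ℤ.- + 66)) :* (m :* 𝟙) :+ (con (fromℤ (+ 3)) :* (M1² :* 𝟙) :+ (con (fromℤ (+ 8)) :* (m :* F3) :+
           (con (fromℤ (ℤ.- + 6)) :* (m² :* M1) :+ (con (fromℤ (+ 24)) :* (m :* M2) :+ (con (fromℤ (+ 6)) :* (M14 :* 𝟙) :+
           (con (fromℤ (ℤ.- + 48)) :* (M2 :* 𝟙) :+ (con (fromℤ (ℤ.- + 30)) :* (m :* M1) :+ (con (fromℤ (+ 84)) :* (M1 :* 𝟙) :+
           (con (fromℤ (ℤ.- + 24)) :* (EM2 :* 𝟙) :+ (con (fromℤ (ℤ.- + 36)) :* (F3 :* 𝟙) :+ con 0ℚ))))))))))))))
         := con (+ 1 / 24) :* m⁴ :+ con (+ 1 / 4) :* m³ :+ con (+ 19 / 24) :* m² :- con (+ 11 / 4) :* m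
           :+ con (+ 1 / 8) :* M1² :+ con (+ 1 / 3) :* (m :* F3) :- con (+ 1 / 4) :* (m² :* M1)
           :+ m :* M2 :+ con (+ 1 / 4) :* M14 :- con (fromℕ 2) :* M2 :- con (+ 5 / 4) :* (m :* M1)
           :+ con (+ 7 / 2) :* M1 :- EM2 :- con (+ 3 / 2) :* F3)
         refl (fromℕ (Graph.size G)) (fromℕ (Graph.size G ^ 2)) (fromℕ (Graph.size G ^ 3)) (fromℕ (Graph.size G ^ 4))
              (fromℕ (M₁ G)) (fromℕ (M₁ G ^ 2)) (fromℕ (M₁^ 4 G)) (fromℕ (M₂ G)) (fromℕ (EM₂ G)) (fromℕ (F G)) ⟩
  _ ∎
  where
  open +-*-Solver
  𝟙 : ∀ {n} → Polynomial n
  𝟙 = con (fromℤ (+ 1))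
  no-short-cycle : ∀ k → k ℕ.< 5 → ¬ Graph.HasCycle G k
  no-short-cycle k k<5 cycle = ℕ.<⇒≱ k<5 (girth≤cycle G 5≤g cycle)
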